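{- Let $C_n(t)$ be the Narayana polynomials and let $C_n^{(4)}(t)$ be defined by $\sum_{n\ge 0}C_n^{(4)}(t)z^n=\Bigl(\sum_{n\ge 0}C_{n+1}(t)z^n\Bigr)^2$. Let $D(n,4,t)=\det\bigl(C_{i+j}^{(4)}(t)\bigr)_{i,j=0}^{n-1}$. Then for all integers $n\ge 0$ $$D(2n,4,t)=(-1)^n\,t^{2(n^2-n)}\,[n+1]_{t^2},\qquad D(2n+1,4,t)=(-1)^n\,t^{2n^2}\,[n+1]_{t^2}.$$
   Context: The Narayana polynomials are $C_0(t)=1$ and $C_n(t)=\sum_{k=0}^{n}\binom nk\binom{n-1}{k}\frac{1}{k+1}t^k$ for $n>0$. Notation: $[n]_q=1+q+\cdots+q^{n-1}$, so $[n+1]_{t^2}=1+t^2+t^4+\cdots+t^{2n}$. Identities are between polynomials in the indeterminate $t$. The determinant of the empty ($0\times 0$) matrix is $1$. -}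

module Defs where

open import Algebra.Bundles.Raw using (RawRing)
import Algebra.Definitions.RawSemiring as RawSemiringDefs
open import Data.Fin.Base using (Fin; zero; suc; toℕ; punchIn)
open import Data.Integer.Base using (+_)
open import Data.List.Base using (List; []; _∷_; map)
open import Data.Nat.Base as ℕ using (ℕ; zero; suc)
open import Data.Nat.Combinatorics using () renaming (_C_ to _choose_)
open import Data.Rational.Base as ℚ using (ℚ)

-- R[t]. A polynomial is its list of coefficients, constant term first;
-- trailing zeros are allowed, so equality is equality of all coefficients.
module Polynomial {c ℓ} (R : RawRing c ℓ) where
  open RawRing R

  Poly : Set c
  Poly = List Carrier

  coeff : Poly → ℕ → Carrier
  coeff []      _       = 0#
  coeff (a ∷ p) zero    = a
  coeff (a ∷ p) (suc k) = coeff p k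

  _≈ₚ_ : Poly → Poly → Set ℓ
  p ≈ₚ q = ∀ k → coeff p k ≈ coeff q k

  _+ₚ_ : Poly → Poly → Poly
  []      +ₚ q       = q
  (a ∷ p) +ₚ []      = a ∷ p
  (a ∷ p) +ₚ (b ∷ q) = (a + b) ∷ (p +ₚ q)

  _*ₚ_ : Poly → Poly → Poly
  []      *ₚ q = []
  (a ∷ p) *ₚ q = map (a *_) q +ₚ (0# ∷ (p *ₚ q))

  const : Carrier → Poly
  const a = a ∷ []

  var : Poly
  var = 0# ∷ 1# ∷ []

  polynomialRing : RawRing c ℓ
  polynomialRing = record
    { Carrier = Poly
    ; _≈_     = _≈ₚ_
    ; _+_     = _+ₚ_
    ; _*_     = _*ₚ_
    ; -_      = map -_
    ; 0#      = []
    ; 1#      = const 1#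
    }

module OverRing {c ℓ} (R : RawRing c ℓ) where
  open RawRing R
  open RawSemiringDefs rawSemiring using (sum; _^_)

  Matrix : ℕ → Set c
  Matrix n = Fin n → Fin n → Carrier

  -- Laplace expansion along row 0.
  det : ∀ n → Matrix n → Carrier
  det zero    A = 1#
  det (suc n) A = sum λ j →
    (- 1#) ^ toℕ j * (A zero j * det n (λ i k → A (suc i) (punchIn j k)))

  -- The formal power series  ∑ aₙ zⁿ  is its coefficient sequence n ↦ aₙ.
  PowerSeries : Set c
  PowerSeries = ℕ → Carrier

  _⊛_ : PowerSeries → PowerSeries → PowerSeries
  (f ⊛ g) n = sum {suc n} λ i → f (toℕ i) * g (n ℕ.∸ toℕ i)

  -- The q-integer  [ n ] q  =  1 + q + ⋯ + qⁿ⁻¹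
  [_]_ : ℕ → Carrier → Carrier
  [ n ] q = sum {n} λ i → q ^ toℕ i

open Polynomial ℚ.+-*-rawRing public using (const) renaming (polynomialRing to ℚ[t]; var to t)
open RawRing ℚ[t] public using (_≈_; _+_; _*_; -_; 0#; 1#) renaming (Carrier to Poly)
open RawSemiringDefs (RawRing.rawSemiring ℚ[t]) public using (sum; _^_)
open OverRing ℚ[t] public

narayana : ℕ → Poly
narayana zero      = 1#
narayana n@(suc m) = sum {suc n} λ i → let k = toℕ i in
  const (+ ((n choose k) ℕ.* (m choose k)) ℚ./ suc k) * t ^ k

shiftedNarayana : PowerSeries
shiftedNarayana n = narayana (suc n)

narayana⁽⁴⁾ : PowerSeries
narayana⁽⁴⁾ = shiftedNarayana ⊛ shiftedNarayana

-- D(n,4,t)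
D₄ : ℕ → Poly
D₄ n = det n λ i j → narayana⁽⁴⁾ (toℕ i ℕ.+ toℕ j)

{-# OPTIONS --safe #-}

-- C(z) = ∑ Cₙ₊₁(t) zⁿ counts Motzkin paths with level weight b = 1 + t and down
-- weight t (on coefficients this is the Lindström–Gessel–Viennot determinant),
-- and splitting a path to height 1 at its last step up from height 0 shows that
-- the coefficients of C(z)² count paths to height 1 with one step more. Their
-- Hankel matrix is brought to triangular form by column operations: the new
-- columns are read off orthogonal polynomials for the measure x (x - b) dμ, where
-- μ has moments Cₙ₊₁(t). By Christoffel's formula these are combinations of the
-- orthogonal polynomials pₙ of μ divided by x (x - b), and are explicit because
-- pₙ(b) vanishes for odd n while pₙ(0) = ± (1 + t + ⋯ + tⁿ). The odd ones are
-- scaled by [m+1]_{t²} to avoid fractions, and this factor is cancelled in ℚ[t].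
module Submission where

open import Algebra.Bundles using (CommutativeRing)
open import Algebra.Bundles.Raw using (RawRing)
open import Algebra.Structures using (IsAbelianGroup)
open import Data.Fin.Base using (Fin; zero; suc; toℕ; punchIn)
import Data.Integer.Base as ℤ
import Data.Integer.Properties as ℤ
open import Data.List.Base using (List; []; _∷_; _++_; _∷ʳ_; map; applyUpTo; tabulate)
open import Data.List.Properties using (applyUpTo-∷ʳ; ++-assoc)
open import Data.List.Membership.Propositional.Properties using (∈-∃++; ∈-applyUpTo⁺)
open import Data.Nat.Base as ℕ using (ℕ; zero; suc; z≤n; s≤s)
open import Data.Nat.Combinatorics using (nCk+nC[k+1]≡[n+1]C[k+1]; k>n⇒nCk≡0; nCn≡1; nCk≡nC[n∸k])
  renaming (_C_ to _choose_)
import Data.Nat.Properties as ℕ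
open import Data.Nat.Solver using (module +-*-Solver)
open import Data.Product.Base using (∃; _×_; _,_; proj₂)
open import Data.Rational.Base as ℚ using (ℚ)
import Data.Rational.Properties as ℚ
import Data.Rational.Unnormalised.Base as ℚᵘ
import Data.Rational.Unnormalised.Properties as ℚᵘ
open import Defs using (module OverRing; module Polynomial)
open import Function.Base using (_∘_)
open import Level using (_⊔_)
open import Relation.Binary.PropositionalEquality as ≡ using (_≡_)
import Relation.Binary.Reasoning.Setoid as SetoidReasoning

-- Determinants

-- To divide out the roots 0 and b one needs, in each degree n, a combination of pₙ, pₙ₊₁, pₙ₊₂ that
-- vanishes at both. For n = 2m the three-term recurrence gives pₙ₊₂ + b pₙ₊₁ + t pₙ = x pₙ₊₁, so
-- the quotient is simply pₙ₊₁ / (x - b). For n = 2m + 1 the outer two already vanish at b, and only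
-- their values at 0 must be balanced; since p₂ₘ₊₁(0) = -(1 + t) [m+1]_{t²}, the common factor 1 + t
-- drops out and q-integers in t² remain. No polynomial in x is ever formed. A polynomial is
-- represented by a column of moments, multiplication by x is the removal of the top entry, and
-- orthogonality becomes the fact that a path cannot climb higher than its number of steps. Each new
-- column then gives the ratio of two consecutive Hankel determinants.

module Determinants {c ℓ} (R : CommutativeRing c ℓ) where
  open CommutativeRing R hiding (zero)
  open import Algebra.Properties.Ring ring
    using (-‿distribʳ-*; -‿involutive; -‿+-comm; -0#≈0#; -1*x≈-x)
  import Algebra.Properties.Semiring.Sum semiring as Sum
  open import Algebra.Definitions.RawSemiring (RawRing.rawSemiring rawRing) using (sum; _^_)
  open import Algebra.Solver.Ring.NaturalCoefficients.Default commutativeSemiring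
    using (solve; _:=_; _:+_; _:*_)
  open import Relation.Binary.Reasoning.Setoid setoid
  open OverRing rawRing

  Column : Set c
  Column = ℕ → Carrier

  Form : Set c
  Form = List Column → Carrier

  -- Laplace expansion along row `r`, with `φ` the minor on the lower rows. Precomposing `φ` with
  -- `u ∷_` puts a skipped column back, and the nested subtractions produce the alternating signs.
  expand : ℕ → Form → Form
  expand r φ []       = 0#
  expand r φ (u ∷ us) = u r * φ us - expand r (φ ∘ (u ∷_)) us

  -- Rows r, …, r + n - 1 of the given columns; 0# unless there are n columns.
  columnDet : ℕ → ℕ → Form
  columnDet zero    r []      = 1#
  columnDet zero    r (_ ∷ _) = 0#
  columnDet (suc n) r us      = expand r (columnDet n (suc r)) us

  expand-cong : ∀ {φ ψ} r → (∀ us → φ us ≈ ψ us) → ∀ us → expand r φ us ≈ expand r ψ us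
  expand-cong r φ≈ψ []       = refl
  expand-cong r φ≈ψ (u ∷ us) =
    +-cong (*-congˡ (φ≈ψ us)) (-‿cong (expand-cong r (φ≈ψ ∘ (u ∷_)) us))

  expand-zero : ∀ {φ} r → (∀ us → φ us ≈ 0#) → ∀ us → expand r φ us ≈ 0#
  expand-zero         r φ≈0 []       = refl
  expand-zero {φ = φ} r φ≈0 (u ∷ us) = begin
    u r * φ us - expand r (φ ∘ (u ∷_)) us ≈⟨ +-cong (*-congˡ (φ≈0 us))
                                                (-‿cong (expand-zero r (φ≈0 ∘ (u ∷_)) us)) ⟩
    u r * 0# - 0#                         ≈⟨ +-cong (zeroʳ (u r)) -0#≈0# ⟩
    0# + 0#                               ≈⟨ +-identityʳ 0# ⟩
    0#                                    ∎

  expand-neg : ∀ {φ ψ} r → (∀ us → φ us ≈ - ψ us) → ∀ us → expand r φ us ≈ - expand r ψ us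
  expand-neg                 r φ≈-ψ []       = sym -0#≈0#
  expand-neg {φ = φ} {ψ = ψ} r φ≈-ψ (u ∷ us) = begin
    u r * φ us - expand r (φ ∘ (u ∷_)) us         ≈⟨ +-cong (*-congˡ (φ≈-ψ us))
                                                        (-‿cong (expand-neg r (φ≈-ψ ∘ (u ∷_)) us)) ⟩
    u r * - ψ us - - expand r (ψ ∘ (u ∷_)) us     ≈⟨ +-congʳ (-‿distribʳ-* (u r) (ψ us)) ⟨
    - (u r * ψ us) - - expand r (ψ ∘ (u ∷_)) us   ≈⟨ -‿+-comm _ _ ⟩
    - (u r * ψ us - expand r (ψ ∘ (u ∷_)) us)     ∎

  -- Alternation is kept apart from antisymmetry because 2 may be a zero divisor in `R`. Linearity
  -- concerns the last column because the elimination replaces only that one.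
  Alternating Antisymmetric LinearInLast : Form → Set _
  Alternating   φ = ∀ us v ws → φ (us ++ v ∷ v ∷ ws) ≈ 0#
  Antisymmetric φ = ∀ us v w xs → φ (us ++ v ∷ w ∷ xs) ≈ - φ (us ++ w ∷ v ∷ xs)
  LinearInLast  φ = ∀ us a {v w x} → (∀ i → x i ≈ a * v i + w i) →
                    φ (us ∷ʳ x) ≈ a * φ (us ∷ʳ v) + φ (us ∷ʳ w)

  x-[x-0]≈0 : ∀ x {y} → y ≈ 0# → x - (x - y) ≈ 0#
  x-[x-0]≈0 x {y} y≈0 = begin
    x - (x - y)      ≈⟨ +-congˡ (-‿cong (trans (+-congˡ (trans (-‿cong y≈0) -0#≈0#)) (+-identityʳ x))) ⟩
    x - x            ≈⟨ -‿inverseʳ x ⟩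
    0#               ∎

  expand-alternating : ∀ {φ} r → Alternating φ → Alternating (expand r φ)
  expand-alternating {φ} r alt [] v ws =
    -- Picking either copy of `v` leaves the same minor with opposite signs; in the remainder both
    -- copies stay inside `φ`.
    x-[x-0]≈0 (v r * φ (v ∷ ws)) (expand-zero r (alt [] v) ws)
  expand-alternating r alt (u ∷ us) v ws = begin
    _             ≈⟨ +-cong (*-congˡ (alt us v ws))
                        (-‿cong (expand-alternating r (alt ∘ (u ∷_)) us v ws)) ⟩
    u r * 0# - 0# ≈⟨ +-cong (zeroʳ (u r)) -0#≈0# ⟩
    0# + 0#       ≈⟨ +-identityʳ 0# ⟩
    0#            ∎

  expand-antisymmetric : ∀ {φ} r → Antisymmetric φ → Antisymmetric (expand r φ)
  expand-antisymmetric {φ} r anti [] v w xs = begin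
    p - (q - e)       ≈⟨ +-congˡ (-‿+-comm q (- e)) ⟨
    p + (- q - - e)   ≈⟨ +-congˡ (+-congˡ (-‿cong (sym
                           (expand-neg r (anti [] w v) xs)))) ⟩
    p + (- q - e′)    ≈⟨ solve 3 (λ p q e → p :+ (q :+ e) := q :+ (p :+ e)) refl p (- q) (- e′) ⟩
    - q + (p - e′)    ≈⟨ +-congˡ (-‿involutive _) ⟨
    - q - - (p - e′)  ≈⟨ -‿+-comm q _ ⟩
    - (q - (p - e′))  ∎
    where
    p q e e′ : Carrier
    p  = v r * φ (w ∷ xs)
    q  = w r * φ (v ∷ xs)
    e  = expand r (λ ys → φ (v ∷ w ∷ ys)) xs
    e′ = expand r (λ ys → φ (w ∷ v ∷ ys)) xs
  expand-antisymmetric {φ} r anti (u ∷ us) v w xs = begin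
    _                   ≈⟨ +-cong (*-congˡ (anti us v w xs))
                              (-‿cong (expand-antisymmetric r (anti ∘ (u ∷_)) us v w xs)) ⟩
    u r * - p - - q     ≈⟨ +-congʳ (-‿distribʳ-* (u r) p) ⟨
    - (u r * p) - - q   ≈⟨ -‿+-comm (u r * p) (- q) ⟩
    - (u r * p - q)     ∎
    where
    p q : Carrier
    p = φ (us ++ w ∷ v ∷ xs)
    q = expand r (φ ∘ (u ∷_)) (us ++ w ∷ v ∷ xs)

  expand-linearInLast : ∀ {φ} r → LinearInLast φ → LinearInLast (expand r φ)
  expand-linearInLast {φ} r lin [] a {v} {w} {x} x≈av+w = begin
    x r * k - 0#                          ≈⟨ +-cong (*-congʳ (x≈av+w r)) -0#≈0# ⟩
    (a * v r + w r) * k + 0#              ≈⟨ solve 5 (λ a v w k z → (a :* v :+ w) :* k :+ z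
                                                := (a :* (v :* k) :+ w :* k) :+ z)
                                                refl a (v r) (w r) k 0# ⟩
    a * (v r * k) + w r * k + 0#          ≈⟨ +-identityʳ _ ⟩
    a * (v r * k) + w r * k               ≈⟨ +-cong (*-congˡ (x-0 _)) (x-0 _) ⟨
    a * (v r * k - 0#) + (w r * k - 0#)   ∎
    where
    k = φ []
    x-0 : ∀ x → x - 0# ≈ x
    x-0 x = trans (+-congˡ -0#≈0#) (+-identityʳ x)
  expand-linearInLast {φ} r lin (u ∷ us) a {v} {w} x≈av+w = begin
    _                                      ≈⟨ +-cong (*-congˡ (lin us a x≈av+w))
                                                (-‿cong (expand-linearInLast r (lin ∘ (u ∷_)) us a x≈av+w)) ⟩
    u r * (a * p + q) - (a * p′ + q′)      ≈⟨ +-congˡ (sym (-‿+-comm _ _)) ⟩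
    u r * (a * p + q) + (- (a * p′) - q′)  ≈⟨ +-congˡ (+-congʳ (-‿distribʳ-* a p′)) ⟩
    u r * (a * p + q) + (a * - p′ - q′)    ≈⟨ solve 6 (λ u a p q p′ q′ →
                                                u :* (a :* p :+ q) :+ (a :* p′ :+ q′)
                                                := a :* (u :* p :+ p′) :+ (u :* q :+ q′))
                                                refl (u r) a p q (- p′) (- q′) ⟩
    a * (u r * p - p′) + (u r * q - q′)    ∎
    where
    p q p′ q′ : Carrier
    p  = φ (us ∷ʳ v)
    q  = φ (us ∷ʳ w)
    p′ = expand r (φ ∘ (u ∷_)) (us ∷ʳ v)
    q′ = expand r (φ ∘ (u ∷_)) (us ∷ʳ w)

  columnDet-alternating : ∀ n r → Alternating (columnDet n r)
  columnDet-alternating zero    r []       v ws = refl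
  columnDet-alternating zero    r (_ ∷ _)  v ws = refl
  columnDet-alternating (suc n) r = expand-alternating r (columnDet-alternating n (suc r))

  columnDet-antisymmetric : ∀ n r → Antisymmetric (columnDet n r)
  columnDet-antisymmetric zero    r []      v w xs = sym -0#≈0#
  columnDet-antisymmetric zero    r (_ ∷ _) v w xs = sym -0#≈0#
  columnDet-antisymmetric (suc n) r = expand-antisymmetric r (columnDet-antisymmetric n (suc r))

  columnDet-linearInLast : ∀ n r → LinearInLast (columnDet n r)
  columnDet-linearInLast zero    r []      a x≈av+w = sym (trans (+-identityʳ _) (zeroʳ a))
  columnDet-linearInLast zero    r (_ ∷ _) a x≈av+w = sym (trans (+-identityʳ _) (zeroʳ a))
  columnDet-linearInLast (suc n) r = expand-linearInLast r (columnDet-linearInLast n (suc r))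

  -- Adjacent swaps carry the first copy of `v` to the right until it meets the second one.
  repeatedColumn : ∀ {φ} → Alternating φ → Antisymmetric φ →
                   ∀ us v ws xs → φ (us ++ v ∷ ws ++ v ∷ xs) ≈ 0#
  repeatedColumn alt anti us v []       xs = alt us v xs
  repeatedColumn {φ} alt anti us v (w ∷ ws) xs = begin
    φ (us ++ v ∷ w ∷ ws ++ v ∷ xs)      ≈⟨ anti us v w _ ⟩
    - φ (us ++ w ∷ v ∷ ws ++ v ∷ xs)    ≈⟨ -‿cong (reflexive (≡.cong φ (++-assoc us (w ∷ []) _))) ⟨
    - φ ((us ∷ʳ w) ++ v ∷ ws ++ v ∷ xs) ≈⟨ -‿cong (repeatedColumn {φ} alt anti (us ∷ʳ w) v ws xs) ⟩
    - 0#                                ≈⟨ -0#≈0# ⟩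
    0#                                  ∎

  expand-lastColumn : ∀ {φ ψ} a r v → (∀ us → φ (us ∷ʳ v) ≈ a * ψ us) → v r ≈ 0# →
                      ∀ us → expand r φ (us ∷ʳ v) ≈ a * expand r ψ us
  expand-lastColumn {φ} a r v φ≈aψ vr≈0 [] = begin
    v r * φ [] - 0#  ≈⟨ +-cong (trans (*-congʳ vr≈0) (zeroˡ _)) -0#≈0# ⟩
    0# + 0#          ≈⟨ +-identityʳ 0# ⟩
    0#               ≈⟨ zeroʳ a ⟨
    a * 0#           ∎
  expand-lastColumn {φ} {ψ} a r v φ≈aψ vr≈0 (u ∷ us) = begin
    _                              ≈⟨ +-cong (*-congˡ (φ≈aψ us))
                                        (-‿cong (expand-lastColumn a r v (φ≈aψ ∘ (u ∷_)) vr≈0 us)) ⟩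
    u r * (a * ψ us) - a * e       ≈⟨ +-congˡ (-‿distribʳ-* a e) ⟩
    u r * (a * ψ us) + a * - e     ≈⟨ solve 4 (λ u a p e → u :* (a :* p) :+ a :* e
                                        := a :* (u :* p :+ e)) refl (u r) a (ψ us) (- e) ⟩
    a * (u r * ψ us - e)           ∎
    where e = expand r (ψ ∘ (u ∷_)) us

  -- Here `p` is the last of the rows r, ..., r + n. Expansion along any earlier row loses the term
  -- that picks `v`, and in row `p` only `v` is left, with sign plus.
  columnDet-lastColumn : ∀ n r {p} v → n ℕ.+ r ≡ p → (∀ i → i ℕ.< p → v i ≈ 0#) →
                         ∀ us → columnDet (suc n) r (us ∷ʳ v) ≈ v p * columnDet n r us
  columnDet-lastColumn zero r v ≡.refl v≈0 [] = trans (+-congˡ -0#≈0#) (+-identityʳ _)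
  -- There are more columns than rows, so both sides are zero.
  columnDet-lastColumn zero r v ≡.refl v≈0 (u ∷ us) = begin
    u r * columnDet zero (suc r) (us ∷ʳ v) - expand r (columnDet zero (suc r) ∘ (u ∷_)) (us ∷ʳ v)
                   ≈⟨ +-cong (*-congˡ (columnDet-∷ʳ us)) (-‿cong (expand-zero r (λ _ → refl) (us ∷ʳ v))) ⟩
    u r * 0# - 0#  ≈⟨ +-cong (zeroʳ (u r)) -0#≈0# ⟩
    0# + 0#        ≈⟨ +-identityʳ 0# ⟩
    0#             ≈⟨ zeroʳ (v r) ⟨
    v r * 0#       ∎
    where
    columnDet-∷ʳ : ∀ us → columnDet zero (suc r) (us ∷ʳ v) ≈ 0#
    columnDet-∷ʳ []      = refl
    columnDet-∷ʳ (_ ∷ _) = refl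
  columnDet-lastColumn (suc n) r {p} v n+r≡p v≈0 =
    expand-lastColumn (v p) r v
      (columnDet-lastColumn n (suc r) v (≡.trans (ℕ.+-suc n r) n+r≡p) v≈0)
      (v≈0 r (≡.subst (r ℕ.<_) n+r≡p (s≤s (ℕ.m≤n+m r n))))

  expand-tabulate : ∀ {n} r φ (h : Fin (suc n) → Column) →
    expand r φ (tabulate h) ≈
    sum (λ j → (- 1#) ^ toℕ j * (h j r * φ (tabulate (h ∘ punchIn j))))
  expand-tabulate {zero} r φ h = begin
    p - 0#        ≈⟨ +-cong (sym (*-identityˡ p)) -0#≈0# ⟩
    1# * p + 0#   ∎
    where p = h zero r * φ []
  expand-tabulate {suc n} r φ h = begin
    p - expand r φ′ (tabulate (h ∘ suc))   ≈⟨ +-congˡ (-‿cong (expand-tabulate r φ′ (h ∘ suc))) ⟩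
    p - sum f                              ≈⟨ +-congˡ (-1*x≈-x (sum f)) ⟨
    p + - 1# * sum f                       ≈⟨ +-cong (sym (*-identityˡ p)) (Sum.*-distribˡ-sum (- 1#) f) ⟩
    1# * p + sum (λ j → - 1# * f j)        ≈⟨ +-congˡ (Sum.sum-cong-≋ {suc n} λ j → sym (*-assoc (- 1#) ((- 1#) ^ toℕ j) (g j))) ⟩
    1# * p + sum (λ j → (- 1#) ^ suc (toℕ j) * (h (suc j) r * φ (tabulate (h ∘ punchIn (suc j))))) ∎
    where
    p = h zero r * φ (tabulate (h ∘ suc))
    φ′ = φ ∘ (h zero ∷_)
    f g : Fin (suc n) → Carrier
    g j = h (suc j) r * φ′ (tabulate (h ∘ suc ∘ punchIn j))
    f j = (- 1#) ^ toℕ j * g j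

  -- Deleting the top row of a matrix whose columns are indexed by ℕ only raises the offset, hence
  -- the induction over all `r`.
  det≈columnDet : ∀ n r (A : Matrix n) (h : Fin n → Column) →
                  (∀ i j → A i j ≈ h j (r ℕ.+ toℕ i)) → det n A ≈ columnDet n r (tabulate h)
  det≈columnDet zero    r A h A≈h = refl
  det≈columnDet (suc n) r A h A≈h = begin
    sum (λ j → (- 1#) ^ toℕ j * (A zero j * det n (λ i k → A (suc i) (punchIn j k))))
      ≈⟨ Sum.sum-cong-≋ {suc n} (λ j → *-congˡ {(- 1#) ^ toℕ j} (*-cong (A≈h₀ j)
           (det≈columnDet n (suc r) _ (h ∘ punchIn j) λ i k → A≈h₊ i (punchIn j k)))) ⟩
    sum (λ j → (- 1#) ^ toℕ j * (h j r * columnDet n (suc r) (tabulate (h ∘ punchIn j))))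
      ≈⟨ expand-tabulate r (columnDet n (suc r)) h ⟨
    columnDet (suc n) r (tabulate h) ∎
    where
    A≈h₀ : ∀ j → A zero j ≈ h j r
    A≈h₀ j = trans (A≈h zero j) (reflexive (≡.cong (h j) (ℕ.+-identityʳ r)))
    A≈h₊ : ∀ i j → A (suc i) j ≈ h j (suc r ℕ.+ toℕ i)
    A≈h₊ i j = trans (A≈h (suc i) j) (reflexive (≡.cong (h j) (ℕ.+-suc r (toℕ i))))

-- Hankel determinants

tabulate-toℕ : ∀ {a} {A : Set a} (f : ℕ → A) n → tabulate {n = n} (f ∘ toℕ) ≡ applyUpTo f n
tabulate-toℕ f zero    = ≡.refl
tabulate-toℕ f (suc n) = ≡.cong (f 0 ∷_) (tabulate-toℕ (f ∘ suc) n)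

module HankelElimination {c ℓ} (R : CommutativeRing c ℓ) (g : ℕ → CommutativeRing.Carrier R) where
  open CommutativeRing R hiding (zero)
  open import Algebra.Solver.Ring.NaturalCoefficients.Default commutativeSemiring
    using (solve; _:=_; _:+_; _:*_)
  open import Algebra.Properties.Ring ring using (-1*x≈-x)
  open import Relation.Binary.Reasoning.Setoid setoid
  open OverRing rawRing
  open Determinants R

  hankelColumn : ℕ → Column
  hankelColumn j i = g (i ℕ.+ j)

  hankelDet : ℕ → Carrier
  hankelDet n = columnDet n 0 (applyUpTo hankelColumn n)

  det≈hankelDet : ∀ n {f : ℕ → Carrier} → (∀ i → f i ≈ g i) → det n (λ i j → f (toℕ i ℕ.+ toℕ j)) ≈ hankelDet n
  det≈hankelDet n {f} f≈g = begin
    det n (λ i j → f (toℕ i ℕ.+ toℕ j))            ≈⟨ det≈columnDet n 0 (λ i j → f (toℕ i ℕ.+ toℕ j)) (hankelColumn ∘ toℕ)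
                                                        (λ i j → f≈g (toℕ i ℕ.+ toℕ j)) ⟩
    columnDet n 0 (tabulate (hankelColumn ∘ toℕ))  ≡⟨ ≡.cong (columnDet n 0) (tabulate-toℕ hankelColumn n) ⟩
    hankelDet n                                    ∎

  -- Read the j-th Hankel column as xʲ: then `Span n` means degree below `n`, and `Leads a n` means
  -- degree `n` with leading coefficient `a`. Pointwise equations in the constructors make both
  -- invariant under equality of columns.
  data Span : ℕ → Column → Set (c ⊔ ℓ) where
    nil  : ∀ {v} → (∀ i → v i ≈ 0#) → Span zero v
    snoc : ∀ {n v w} a → Span n w → (∀ i → v i ≈ a * hankelColumn n i + w i) → Span (suc n) v

  Leads : Carrier → ℕ → Column → Set (c ⊔ ℓ)
  Leads a n v = ∃ λ w → Span n w × (∀ i → v i ≈ a * hankelColumn n i + w i)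

  leads⇒span : ∀ {a n v} → Leads a n v → Span (suc n) v
  leads⇒span {a} (_ , w∈ , v≈) = snoc a w∈ v≈

  span-zero : ∀ {v} n → (∀ i → v i ≈ 0#) → Span n v
  span-zero zero    v≈0 = nil v≈0
  span-zero (suc n) v≈0 = snoc 0# (span-zero {λ _ → 0#} n λ _ → refl) λ i →
    trans (v≈0 i) (sym (trans (+-identityʳ _) (zeroˡ _)))

  span-weaken : ∀ {n v} → Span n v → Span (suc n) v
  span-weaken v∈ = snoc 0# v∈ λ i → sym (trans (+-congʳ (zeroˡ _)) (+-identityˡ _))

  span-axpy : ∀ {n v w x} a → Span n v → Span n w → (∀ i → x i ≈ a * v i + w i) → Span n x
  span-axpy {x = x} a (nil {v} v≈0) (nil {w} w≈0) x≈ = nil λ i → begin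
    x i            ≈⟨ x≈ i ⟩
    a * v i + w i  ≈⟨ +-cong (trans (*-congˡ (v≈0 i)) (zeroʳ a)) (w≈0 i) ⟩
    0# + 0#        ≈⟨ +-identityʳ 0# ⟩
    0#             ∎
  span-axpy {x = x} a (snoc {n} {v} {v′} b v′∈ v≈) (snoc {v = w} {w = w′} d w′∈ w≈) x≈ =
    snoc (a * b + d) (span-axpy a v′∈ w′∈ (λ _ → refl)) λ i → begin
      x i                                    ≈⟨ x≈ i ⟩
      a * v i + w i                          ≈⟨ +-cong (*-congˡ (v≈ i)) (w≈ i) ⟩
      a * (b * h i + v′ i) + (d * h i + w′ i) ≈⟨ solve 6 (λ a b d h v w →
        a :* (b :* h :+ v) :+ (d :* h :+ w) := (a :* b :+ d) :* h :+ (a :* v :+ w))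
        refl a b d (h i) (v′ i) (w′ i) ⟩
      (a * b + d) * h i + (a * v′ i + w′ i)  ∎
    where h = hankelColumn n

  -- This is multiplication by x: in a Hankel matrix, column `n` without its top entry is column
  -- `suc n`.
  span-shift : ∀ {n v} → Span n v → Span (suc n) (v ∘ suc)
  span-shift (nil v≈0)        = span-zero 1 (v≈0 ∘ suc)
  span-shift {suc n} {v} (snoc {w = w} a w∈ v≈) = snoc a (span-shift w∈) λ i → begin
    v (suc i)                                   ≈⟨ v≈ (suc i) ⟩
    a * g (suc (i ℕ.+ n)) + w (suc i)           ≡⟨ ≡.cong (λ k → a * g k + w (suc i)) (ℕ.+-suc i n) ⟨
    a * g (i ℕ.+ suc n) + w (suc i)             ∎

  leads-shift : ∀ {a n v} → Leads a n v → Leads a (suc n) (v ∘ suc)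
  leads-shift {a} {n} {v} (w , w∈ , v≈) = w ∘ suc , span-shift w∈ , λ i → begin
    v (suc i)                                   ≈⟨ v≈ (suc i) ⟩
    a * g (suc (i ℕ.+ n)) + w (suc i)           ≡⟨ ≡.cong (λ k → a * g k + w (suc i)) (ℕ.+-suc i n) ⟨
    a * g (i ℕ.+ suc n) + w (suc i)             ∎

  leads-axpy : ∀ {a n v w x} b → Leads a n v → Span n w → (∀ i → x i ≈ b * v i + w i) →
               Leads (b * a) n x
  leads-axpy {a} {n} {v} {w} {x} b (v′ , v′∈ , v≈) w∈ x≈ =
    _ , span-axpy b v′∈ w∈ (λ _ → refl) , λ i → begin
      x i                                         ≈⟨ x≈ i ⟩
      b * v i + w i                               ≈⟨ +-congʳ (*-congˡ (v≈ i)) ⟩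
      b * (a * hankelColumn n i + v′ i) + w i     ≈⟨ solve 5 (λ a b h v w →
        b :* (a :* h :+ v) :+ w := (b :* a) :* h :+ (b :* v :+ w))
        refl a b (hankelColumn n i) (v′ i) (w i) ⟩
      b * a * hankelColumn n i + (b * v′ i + w i) ∎

  leads-resp-≈ : ∀ {a a′ n v} → a ≈ a′ → Leads a n v → Leads a′ n v
  leads-resp-≈ a≈a′ (w , w∈ , v≈) = w , w∈ , λ i → trans (v≈ i) (+-congʳ (*-congʳ a≈a′))

  span-scale : ∀ {n v} a → Span n v → Span n (λ i → a * v i)
  span-scale {n} a v∈ = span-axpy a v∈ (span-zero {λ _ → 0#} n λ _ → refl) λ _ → sym (+-identityʳ _)

  bordered : ℕ → Column → Carrier
  bordered n v = columnDet (suc n) 0 (applyUpTo hankelColumn n ∷ʳ v)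

  bordered-hankelColumn : ∀ {n k} → k ℕ.< n → bordered n (hankelColumn k) ≈ 0#
  bordered-hankelColumn {n} {k} k<n
    with us , ws , eq ← ∈-∃++ (∈-applyUpTo⁺ hankelColumn k<n) = begin
      bordered n h                                   ≡⟨ ≡.cong (λ xs → columnDet (suc n) 0 (xs ∷ʳ h)) eq ⟩
      columnDet (suc n) 0 ((us ++ h ∷ ws) ∷ʳ h)      ≡⟨ ≡.cong (columnDet (suc n) 0) (++-assoc us (h ∷ ws) (h ∷ [])) ⟩
      columnDet (suc n) 0 (us ++ h ∷ ws ++ h ∷ [])   ≈⟨ repeatedColumn {columnDet (suc n) 0}
                                                          (columnDet-alternating (suc n) 0)
                                                          (columnDet-antisymmetric (suc n) 0) us h ws [] ⟩
      0#                                             ∎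
    where h = hankelColumn k

  bordered-span : ∀ {n k v} → k ℕ.≤ n → Span k v → bordered n v ≈ 0#
  bordered-span {n} {v = v} _ (nil v≈0) = begin
    -- A zero column satisfies v = -v + v, so linearity alone forces its determinant to vanish.
    bordered n v                       ≈⟨ columnDet-linearInLast (suc n) 0 (applyUpTo hankelColumn n) (- 1#)
                                            {v} {v} (λ i → trans (v≈0 i) (sym (-1*x+x≈0 (v i)))) ⟩
    - 1# * bordered n v + bordered n v ≈⟨ -1*x+x≈0 _ ⟩
    0#                                 ∎
    where
    -1*x+x≈0 : ∀ x → - 1# * x + x ≈ 0#
    -1*x+x≈0 x = trans (+-congʳ (-1*x≈-x x)) (-‿inverseˡ x)
  bordered-span {n} {suc k} {v} k<n (snoc {w = w} a w∈ v≈) = begin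
    bordered n v                                     ≈⟨ columnDet-linearInLast (suc n) 0 (applyUpTo hankelColumn n) a v≈ ⟩
    a * bordered n (hankelColumn k) + bordered n w   ≈⟨ +-cong (trans (*-congˡ (bordered-hankelColumn k<n)) (zeroʳ a))
                                                          (bordered-span (ℕ.<⇒≤ k<n) w∈) ⟩
    0# + 0#                                          ≈⟨ +-identityʳ 0# ⟩
    0#                                               ∎

  -- Replacing the last Hankel column by `v` multiplies the determinant by `a`, as the rest of `v`
  -- depends on the earlier columns. The new last column is zero except at the bottom.
  hankelDet-step : ∀ {a n v} → Leads a n v → (∀ i → i ℕ.< n → v i ≈ 0#) →
                   a * hankelDet (suc n) ≈ v n * hankelDet n
  hankelDet-step {a} {n} {v} (w , w∈ , v≈) v≈0 = begin
    a * hankelDet (suc n)                            ≡⟨ ≡.cong (λ us → a * columnDet (suc n) 0 us)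
                                                          (applyUpTo-∷ʳ hankelColumn n) ⟨
    a * bordered n (hankelColumn n)                  ≈⟨ +-identityʳ _ ⟨
    a * bordered n (hankelColumn n) + 0#             ≈⟨ +-congˡ (bordered-span ℕ.≤-refl w∈) ⟨
    a * bordered n (hankelColumn n) + bordered n w   ≈⟨ columnDet-linearInLast (suc n) 0 (applyUpTo hankelColumn n) a v≈ ⟨
    bordered n v                                     ≈⟨ columnDet-lastColumn n 0 v (ℕ.+-identityʳ n) v≈0 _ ⟩
    v n * hankelDet n                                ∎

-- Motzkin paths

-- Makes the truncated subtraction in the exponent `m ^ 2 ∸ m` a genuine one.
m≤m^2 : ∀ m → m ℕ.≤ m ℕ.^ 2
m≤m^2 zero    = z≤n
m≤m^2 (suc m) = ℕ.m≤m*n (suc m) (suc m ℕ.* 1)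

m+m^2≡[1+m]^2∸[1+m] : ∀ m → m ℕ.+ m ℕ.^ 2 ≡ suc m ℕ.^ 2 ℕ.∸ suc m
m+m^2≡[1+m]^2∸[1+m] m rewrite ℕ.*-identityʳ m =
  ≡.trans (≡.sym (ℕ.*-suc m m)) (≡.sym (ℕ.m+n∸m≡n m (m ℕ.* suc m)))

module MotzkinPaths {c ℓ} (R : CommutativeRing c ℓ) (t : CommutativeRing.Carrier R) where
  open CommutativeRing R hiding (zero)
  open import Algebra.Solver.Ring.NaturalCoefficients.Default commutativeSemiring
    using (solve; _:=_; _:+_; _:*_; con)
  open import Algebra.Properties.Ring ring using (-1*x≈-x; -0#≈0#; +-cancelʳ)
  open import Algebra.Properties.Semiring.Exp semiring using (^-homo-*)
  import Algebra.Properties.Semiring.Sum semiring as Sum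
  open import Algebra.Definitions.RawSemiring (RawRing.rawSemiring rawRing) using (_^_)
  open import Relation.Binary.Reasoning.Setoid setoid
  open OverRing rawRing
  open Determinants R using (Column)

  b q : Carrier
  b = 1# + t
  q = t ^ 2

  -- Weighted Motzkin paths from height 0 to height n in i steps; a step
  -- up, level or down has weight 1, 1 + t or t.
  paths : ℕ → ℕ → Carrier
  paths zero    zero    = 1#
  paths zero    (suc n) = 0#
  paths (suc i) zero    = b * paths i 0 + t * paths i 1
  paths (suc i) (suc n) = paths i n + (b * paths i (suc n) + t * paths i (suc (suc n)))

  paths-low : ∀ {i n} → i ℕ.< n → paths i n ≈ 0#
  paths-low {zero}  {suc n} _         = refl
  paths-low {suc i} {suc n} (s≤s i<n) = begin
    paths i n + (b * paths i (suc n) + t * paths i (suc (suc n)))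
      ≈⟨ +-cong (paths-low i<n) (+-cong (*-congˡ (paths-low (ℕ.m<n⇒m<1+n i<n)))
                                        (*-congˡ (paths-low (ℕ.m<n⇒m<1+n (ℕ.m<n⇒m<1+n i<n))))) ⟩
    0# + (b * 0# + t * 0#)  ≈⟨ solve 2 (λ b t → con 0 :+ (b :* con 0 :+ t :* con 0) := con 0) refl b t ⟩
    0#                      ∎

  paths-diagonal : ∀ n → paths n n ≈ 1#
  paths-diagonal zero    = refl
  paths-diagonal (suc n) = begin
    paths n n + (b * paths n (suc n) + t * paths n (suc (suc n)))
      ≈⟨ +-cong (paths-diagonal n) (+-cong (*-congˡ (paths-low {n} ℕ.≤-refl)) (*-congˡ (paths-low (ℕ.n≤1+n (suc n))))) ⟩
    1# + (b * 0# + t * 0#)  ≈⟨ solve 2 (λ b t → con 1 :+ (b :* con 0 :+ t :* con 0) := con 1) refl b t ⟩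
    1#                      ∎

  ⊛-distribʳ-+ : ∀ u v f i → ((λ j → u j + v j) ⊛ f) i ≈ (u ⊛ f) i + (v ⊛ f) i
  ⊛-distribʳ-+ u v f i = trans
    (Sum.sum-cong-≋ {suc i} λ j → distribʳ (f (i ℕ.∸ toℕ j)) (u (toℕ j)) (v (toℕ j)))
    (Sum.∑-distrib-+ {suc i} (λ j → u (toℕ j) * f (i ℕ.∸ toℕ j)) (λ j → v (toℕ j) * f (i ℕ.∸ toℕ j)))

  ⊛-scaleˡ : ∀ a u f i → ((λ j → a * u j) ⊛ f) i ≈ a * (u ⊛ f) i
  ⊛-scaleˡ a u f i = trans
    (Sum.sum-cong-≋ {suc i} λ j → *-assoc a (u (toℕ j)) (f (i ℕ.∸ toℕ j)))
    (sym (Sum.*-distribˡ-sum {suc i} a (λ j → u (toℕ j) * f (i ℕ.∸ toℕ j))))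

  -- A path to height n + 1 is cut at its last step from height n to height n + 1.
  paths-⊛ : ∀ i n → ((λ j → paths j n) ⊛ (λ j → paths j 0)) i ≈ paths (suc i) (suc n)
  paths-⊛ zero n = solve 3 (λ b t x → x :* con 1 :+ con 0 := x :+ (b :* con 0 :+ t :* con 0)) refl b t (paths 0 n)
  paths-⊛ (suc i) zero = begin
    1# * paths (suc i) 0 + ((λ j → b * paths j 0 + t * paths j 1) ⊛ f) i
      ≈⟨ +-cong (*-identityˡ _) (trans (⊛-distribʳ-+ (λ j → b * paths j 0) (λ j → t * paths j 1) f i)
                                       (+-cong (⊛-scaleˡ b f f i) (⊛-scaleˡ t (λ j → paths j 1) f i))) ⟩
    paths (suc i) 0 + (b * (f ⊛ f) i + t * ((λ j → paths j 1) ⊛ f) i)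
      ≈⟨ +-congˡ (+-cong (*-congˡ (paths-⊛ i 0)) (*-congˡ (paths-⊛ i 1))) ⟩
    paths (suc (suc i)) 1 ∎
    where
    f : Column
    f j = paths j 0
  paths-⊛ (suc i) (suc n) = begin
    0# * paths (suc i) 0 + ((λ j → u j + (b * v j + t * w j)) ⊛ f) i
      ≈⟨ trans (+-congʳ (zeroˡ _)) (+-identityˡ _) ⟩
    ((λ j → u j + (b * v j + t * w j)) ⊛ f) i
      ≈⟨ ⊛-distribʳ-+ u (λ j → b * v j + t * w j) f i ⟩
    (u ⊛ f) i + ((λ j → b * v j + t * w j) ⊛ f) i
      ≈⟨ +-congˡ (trans (⊛-distribʳ-+ (λ j → b * v j) (λ j → t * w j) f i)
                        (+-cong (⊛-scaleˡ b v f i) (⊛-scaleˡ t w f i))) ⟩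
    (u ⊛ f) i + (b * (v ⊛ f) i + t * (w ⊛ f) i)
      ≈⟨ +-cong (paths-⊛ i n) (+-cong (*-congˡ (paths-⊛ i (suc n))) (*-congˡ (paths-⊛ i (suc (suc n))))) ⟩
    paths (suc (suc i)) (suc (suc n)) ∎
    where
    f u v w : Column
    f j = paths j 0
    u j = paths j n
    v j = paths j (suc n)
    w j = paths j (suc (suc n))

  -- Let L be the functional with L(xⁱ) = paths i 0 and p₀, p₁, … its orthogonal
  -- polynomials, pₙ₊₁ = (x - b) pₙ - t pₙ₋₁. Attach to f the column with entries
  -- L(xⁱ⁺¹ p₁ f) / t, so that the k-th Hankel column belongs to xᵏ. Formally,
  -- oddHeight (1 + m) belongs to p₂ₘ₊₁ / (x p₁), evenColumn (1 + m) to p₂ₘ₊₁ / p₁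
  -- and oddColumn (1 + m) to ([m+1] p₂ₘ₊₃ - [m+2] p₂ₘ₊₁) / (x p₁); the last two are
  -- polynomials, of degrees 2m and 2m + 1.
  oddHeight : ℕ → Column
  oddHeight zero    i = 0#
  oddHeight (suc m) i = q ^ m * paths i (suc (m ℕ.* 2))

  -- Since L(xⁱ pₙ) is tⁿ times `paths i n`, the factor `q ^ m` turns `oddHeight (suc m) i` into
  -- L(xⁱ p₂ₘ₊₁) / t. Two uses of the three-term recurrence give pₙ₊₂ + t² pₙ₋₂ = ((x - b)² - 2t)
  -- pₙ, and b² - 2t = 1 + q. The negative term -2b x is moved to the other side.
  oddHeight-recurrence : ∀ m i →
    oddHeight (suc (suc m)) i + (q * oddHeight m i + (b + b) * oddHeight (suc m) (suc i)) ≈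
    (1# + q) * oddHeight (suc m) i + oddHeight (suc m) (suc (suc i))
  -- Now pₙ₋₂ is p₋₁ = 0, and paths ending at height 0 have no last step from below.
  oddHeight-recurrence zero i = solve 5 (λ t x₀ x₁ x₂ x₃ →
      let b = con 1 :+ t
          q = t :* (t :* con 1)
      in
      q :* con 1 :* x₃ :+ (q :* con 0 :+ (b :+ b) :* (con 1 :* (x₀ :+ (b :* x₁ :+ t :* x₂))))
      := (con 1 :+ q) :* (con 1 :* x₁)
         :+ con 1 :* ((b :* x₀ :+ t :* x₁)
                      :+ (b :* (x₀ :+ (b :* x₁ :+ t :* x₂)) :+ t :* (x₁ :+ (b :* x₂ :+ t :* x₃)))))
    refl t (paths i 0) (paths i 1) (paths i 2) (paths i 3)
  oddHeight-recurrence (suc m) i = solve 7 (λ t p x₁ x₂ x₃ x₄ x₅ →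
      let b = con 1 :+ t
          q = t :* (t :* con 1)
      in
      q :* (q :* p) :* x₅ :+ (q :* (p :* x₁) :+ (b :+ b) :* (q :* p :* (x₂ :+ (b :* x₃ :+ t :* x₄))))
      := (con 1 :+ q) :* (q :* p :* x₃)
         :+ q :* p :* ((x₁ :+ (b :* x₂ :+ t :* x₃))
                       :+ (b :* (x₂ :+ (b :* x₃ :+ t :* x₄)) :+ t :* (x₃ :+ (b :* x₄ :+ t :* x₅)))))
    refl t (q ^ m) (paths i k) (paths i (1 ℕ.+ k)) (paths i (2 ℕ.+ k)) (paths i (3 ℕ.+ k)) (paths i (4 ℕ.+ k))
    where k = suc (m ℕ.* 2)

  qInteger-suc : ∀ n → [ suc n ] q ≈ 1# + q * [ n ] q
  qInteger-suc n = +-congˡ (sym (Sum.*-distribˡ-sum {n} q λ i → q ^ toℕ i))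

  oddColumn : ℕ → Column
  oddColumn m i = [ m ] q * oddHeight (suc m) i - [ suc m ] q * oddHeight m i

  -- By (1 + q) [m+1] = [m+2] + q [m], the terms without a factor x combine to q times the previous
  -- odd column. All others are shifts, so divisibility by x is inherited inductively.
  oddColumn-recurrence : ∀ m i → oddColumn (suc m) i ≈
    [ suc m ] q * oddHeight (suc m) (suc (suc i)) +
    (q * oddColumn m i + - ([ suc m ] q * (b + b)) * oddHeight (suc m) (suc i))
  -- `z` collects the subtracted terms of both sides: the solver knows only semirings, and negations
  -- enter it as opaque variables.
  oddColumn-recurrence m i = +-cancelʳ z _ _ (begin
    B₁ * s₂ - B₂ * s₁ + z
      ≈⟨ solve 9 (λ B₁ B₂ s₀ s₁ s₂ e q b n →
           (B₁ :* s₂ :+ n) :+ (B₂ :* s₁ :+ (q :* (B₁ :* s₀) :+ B₁ :* b :* e))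
           := B₁ :* (s₂ :+ (q :* s₀ :+ b :* e)) :+ (B₂ :* s₁ :+ n))
           refl B₁ B₂ s₀ s₁ s₂ e q (b + b) (- (B₂ * s₁)) ⟩
    B₁ * (s₂ + (q * s₀ + (b + b) * e)) + (B₂ * s₁ - B₂ * s₁)
      ≈⟨ +-cong (*-congˡ (oddHeight-recurrence m i)) (-‿inverseʳ _) ⟩
    B₁ * ((1# + q) * s₁ + e′) + 0#
      ≈⟨ solve 4 (λ B₁ q s₁ e′ →
           B₁ :* ((con 1 :+ q) :* s₁ :+ e′) :+ con 0
           := B₁ :* e′ :+ (B₁ :+ q :* B₁) :* s₁) refl B₁ q s₁ e′ ⟩
    B₁ * e′ + (B₁ + q * B₁) * s₁
      ≈⟨ +-congˡ (*-congʳ (+-congʳ (qInteger-suc m))) ⟩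
    B₁ * e′ + (1# + q * B₀ + q * B₁) * s₁
      ≈⟨ solve 5 (λ B₀ B₁ q s₁ e′ →
           B₁ :* e′ :+ (con 1 :+ q :* B₀ :+ q :* B₁) :* s₁
           := B₁ :* e′ :+ ((con 1 :+ q :* B₁) :* s₁ :+ q :* (B₀ :* s₁)) :+ con 0) refl B₀ B₁ q s₁ e′ ⟩
    B₁ * e′ + ((1# + q * B₁) * s₁ + q * (B₀ * s₁)) + 0#
      ≈⟨ +-cong (+-congˡ (+-congʳ (*-congʳ (sym (qInteger-suc (suc m)))))) (sym zeros) ⟩
    B₁ * e′ + (B₂ * s₁ + q * (B₀ * s₁)) + (q * (B₁ * s₀ - B₁ * s₀) + (B₁ * (b + b) - B₁ * (b + b)) * e)
      ≈⟨ solve 11 (λ B₀ B₁ B₂ s₀ s₁ e e′ q b n k →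
           B₁ :* e′ :+ (B₂ :* s₁ :+ q :* (B₀ :* s₁)) :+ (q :* (B₁ :* s₀ :+ n) :+ (B₁ :* b :+ k) :* e)
           := (B₁ :* e′ :+ (q :* (B₀ :* s₁ :+ n) :+ k :* e)) :+ (B₂ :* s₁ :+ (q :* (B₁ :* s₀) :+ B₁ :* b :* e)))
           refl B₀ B₁ B₂ s₀ s₁ e e′ q (b + b) (- (B₁ * s₀)) (- (B₁ * (b + b))) ⟩
    (B₁ * e′ + (q * (B₀ * s₁ - B₁ * s₀) + - (B₁ * (b + b)) * e)) + z ∎)
    where
    B₀ B₁ B₂ s₀ s₁ s₂ e e′ z : Carrier
    B₀ = [ m ] q
    B₁ = [ suc m ] q
    B₂ = [ suc (suc m) ] q
    s₀ = oddHeight m i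
    s₁ = oddHeight (suc m) i
    s₂ = oddHeight (suc (suc m)) i
    e  = oddHeight (suc m) (suc i)
    e′ = oddHeight (suc m) (suc (suc i))
    z  = B₂ * s₁ + (q * (B₁ * s₀) + B₁ * (b + b) * e)
    zeros : q * (B₁ * s₀ - B₁ * s₀) + (B₁ * (b + b) - B₁ * (b + b)) * e ≈ 0#
    zeros = begin
      _               ≈⟨ +-cong (*-congˡ (-‿inverseʳ _)) (*-congʳ (-‿inverseʳ _)) ⟩
      q * 0# + 0# * e ≈⟨ solve 2 (λ q e → q :* con 0 :+ con 0 :* e := con 0) refl q e ⟩
      0#              ∎

  -- Elimination columns and the recurrences of the Hankel determinants

  firstAscent : Column
  firstAscent i = paths (suc i) 1

  open HankelElimination R firstAscent

  evenColumn : ℕ → Column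
  evenColumn m i = oddHeight m (suc i)

  evenColumn-recurrence : ∀ m i → evenColumn (suc (suc m)) i ≈
    1# * evenColumn (suc m) (suc (suc i)) +
    ((1# + q) * evenColumn (suc m) i + (- (b + b) * evenColumn (suc m) (suc i) + - q * evenColumn m i))
  evenColumn-recurrence m i = +-cancelʳ z _ _ (begin
    e₂ + z  ≈⟨ oddHeight-recurrence m (suc i) ⟩
    (1# + q) * e₁ + e₁″
      ≈⟨ +-identityʳ _ ⟨
    (1# + q) * e₁ + e₁″ + 0#
      ≈⟨ +-congˡ zeros ⟨
    (1# + q) * e₁ + e₁″ + ((- (b + b) + (b + b)) * e₁′ + (- q + q) * e₀)
      ≈⟨ solve 8 (λ b q k n e₀ e₁ e₁′ e₁″ →
           (con 1 :+ q) :* e₁ :+ e₁″ :+ ((k :+ b) :* e₁′ :+ (n :+ q) :* e₀)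
           := (con 1 :* e₁″ :+ ((con 1 :+ q) :* e₁ :+ (k :* e₁′ :+ n :* e₀))) :+ (q :* e₀ :+ b :* e₁′))
           refl (b + b) q (- (b + b)) (- q) e₀ e₁ e₁′ e₁″ ⟩
    (1# * e₁″ + ((1# + q) * e₁ + (- (b + b) * e₁′ + - q * e₀))) + z ∎)
    where
    e₀ e₁ e₂ e₁′ e₁″ z : Carrier
    e₀  = evenColumn m i
    e₁  = evenColumn (suc m) i
    e₂  = evenColumn (suc (suc m)) i
    e₁′ = evenColumn (suc m) (suc i)
    e₁″ = evenColumn (suc m) (suc (suc i))
    z   = q * e₀ + (b + b) * e₁′
    zeros : (- (b + b) + (b + b)) * e₁′ + (- q + q) * e₀ ≈ 0#
    zeros = begin
      _                ≈⟨ +-cong (*-congʳ (-‿inverseˡ _)) (*-congʳ (-‿inverseˡ _)) ⟩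
      0# * e₁′ + 0# * e₀ ≈⟨ solve 2 (λ x y → con 0 :* x :+ con 0 :* y := con 0) refl e₁′ e₀ ⟩
      0#               ∎

  -- The recurrence has order two, so the induction carries two consecutive columns. It starts from
  -- 0 and from the Hankel column of the constant polynomial 1.
  evenColumn-span×leads : ∀ m → Span (m ℕ.* 2) (evenColumn m) × Leads 1# (m ℕ.* 2) (evenColumn (suc m))
  evenColumn-span×leads zero = nil (λ _ → refl) , (λ _ → 0#) , nil (λ _ → refl) , λ i →
    trans (*-congˡ (reflexive (≡.cong firstAscent (≡.sym (ℕ.+-identityʳ i))))) (sym (+-identityʳ _))
  evenColumn-span×leads (suc m) with e₀∈ , e₁∈ ← evenColumn-span×leads m =
    span-weaken (leads⇒span e₁∈) ,
    leads-resp-≈ (*-identityˡ 1#) (leads-axpy 1# (leads-shift (leads-shift e₁∈))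
      (span-axpy (1# + q) (span-weaken (leads⇒span e₁∈))
        (span-axpy (- (b + b)) (span-shift (leads⇒span e₁∈))
          (span-scale (- q) (span-weaken (span-weaken e₀∈)))
          (λ _ → refl))
        (λ _ → refl))
      (evenColumn-recurrence m))

  evenColumn-leads : ∀ m → Leads 1# (m ℕ.* 2) (evenColumn (suc m))
  evenColumn-leads m = proj₂ (evenColumn-span×leads m)

  oddColumn-span : ∀ m → Span (m ℕ.* 2) (oddColumn m)
  -- Only x times the monic `evenColumn (suc m)` reaches the top degree. Its coefficient is the
  -- denominator cleared from p₂ₘ₊₃ - ([m+2] / [m+1]) p₂ₘ₊₁.
  oddColumn-leads : ∀ m → Leads ([ suc m ] q) (suc (m ℕ.* 2)) (oddColumn (suc m))

  oddColumn-span zero    = nil λ i → trans (+-cong (zeroˡ _) (-‿cong (zeroʳ _))) (-‿inverseʳ 0#)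
  oddColumn-span (suc m) = leads⇒span (oddColumn-leads m)

  oddColumn-leads m = leads-resp-≈ (*-identityʳ _) (leads-axpy ([ suc m ] q) (leads-shift (evenColumn-leads m))
    (span-axpy q (span-weaken (oddColumn-span m))
      (span-scale (- ([ suc m ] q * (b + b))) (leads⇒span (evenColumn-leads m)))
      (λ _ → refl))
    (oddColumn-recurrence m))

  -- In row i of the even column the paths have i + 1 steps and must reach height 2m + 1. This is
  -- impossible above the diagonal, and on it only the path of up steps remains.
  hankelDet-odd-step : ∀ m → hankelDet (suc (m ℕ.* 2)) ≈ q ^ m * hankelDet (m ℕ.* 2)
  hankelDet-odd-step m = begin
    hankelDet (suc k)                           ≈⟨ *-identityˡ _ ⟨
    1# * hankelDet (suc k)                      ≈⟨ hankelDet-step (evenColumn-leads m) (λ i i<k →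
                                                     trans (*-congˡ (paths-low (s≤s i<k))) (zeroʳ _)) ⟩
    q ^ m * paths (suc k) (suc k) * hankelDet k ≈⟨ *-congʳ (trans (*-congˡ (paths-diagonal (suc k))) (*-identityʳ _)) ⟩
    q ^ m * hankelDet k                         ∎
    where k = m ℕ.* 2

  -- In all rows up to `k`, height 2m + 3 is out of reach; the other term of the odd column enters
  -- with a minus, which is the source of the signs.
  hankelDet-even-step : ∀ m → [ suc m ] q * hankelDet (suc m ℕ.* 2) ≈
                              - ([ suc (suc m) ] q * q ^ m) * hankelDet (suc (m ℕ.* 2))
  hankelDet-even-step m = begin
    [ suc m ] q * hankelDet (suc m ℕ.* 2)   ≈⟨ hankelDet-step (oddColumn-leads m) (λ i i<k → begin
      oddColumn (suc m) i    ≈⟨ oddColumn-below i (ℕ.m<n⇒m<1+n i<k) ⟩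
      - (B₂ * (q ^ m * paths i k)) ≈⟨ -‿cong (*-congˡ (trans (*-congˡ (paths-low i<k)) (zeroʳ _))) ⟩
      - (B₂ * 0#)     ≈⟨ -‿cong (zeroʳ _) ⟩
      - 0#            ≈⟨ -0#≈0# ⟩
      0#              ∎) ⟩
    oddColumn (suc m) k * hankelDet k             ≈⟨ *-congʳ (oddColumn-below k ℕ.≤-refl) ⟩
    - (B₂ * (q ^ m * paths k k)) * hankelDet k    ≈⟨ *-congʳ (-‿cong (*-congˡ (trans (*-congˡ (paths-diagonal k)) (*-identityʳ _)))) ⟩
    - (B₂ * q ^ m) * hankelDet k                  ∎
    where
    k = suc (m ℕ.* 2)
    B₂ = [ suc (suc m) ] q
    oddColumn-below : ∀ i → i ℕ.< suc k → oddColumn (suc m) i ≈ - (B₂ * (q ^ m * paths i k))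
    oddColumn-below i i≤k = trans (+-congʳ (trans (*-congˡ (trans (*-congˡ (paths-low (ℕ.m<n⇒m<1+n i≤k))) (zeroʳ _))) (zeroʳ _))) (+-identityˡ _)

  -- In a general `R` the q-integers may be zero divisors, so cancellation is a parameter, supplied
  -- below for ℚ[t].
  module _ (cancel : ∀ m {x y} → [ suc m ] q * x ≈ [ suc m ] q * y → x ≈ y) where

    -- The two steps alternate: each contributes `q ^ m`, and the ratios [m+2] / [m+1] telescope.
    hankelDet-even : ∀ m → hankelDet (m ℕ.* 2) ≈ (- 1#) ^ m * q ^ (m ℕ.^ 2 ℕ.∸ m) * [ suc m ] q
    hankelDet-odd  : ∀ m → hankelDet (suc (m ℕ.* 2)) ≈ (- 1#) ^ m * q ^ (m ℕ.^ 2) * [ suc m ] q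

    hankelDet-odd m = begin
      hankelDet (suc (m ℕ.* 2))                  ≈⟨ hankelDet-odd-step m ⟩
      q ^ m * hankelDet (m ℕ.* 2)                ≈⟨ *-congˡ (hankelDet-even m) ⟩
      q ^ m * (ε * q ^ (m ℕ.^ 2 ℕ.∸ m) * B)      ≈⟨ solve 4 (λ x ε y B → x :* (ε :* y :* B) := ε :* (x :* y) :* B)
                                                     refl (q ^ m) ε (q ^ (m ℕ.^ 2 ℕ.∸ m)) B ⟩
      ε * (q ^ m * q ^ (m ℕ.^ 2 ℕ.∸ m)) * B      ≈⟨ *-congʳ (*-congˡ (^-homo-* q m (m ℕ.^ 2 ℕ.∸ m))) ⟨
      ε * q ^ (m ℕ.+ (m ℕ.^ 2 ℕ.∸ m)) * B        ≡⟨ ≡.cong (λ k → ε * q ^ k * B) (ℕ.m+[n∸m]≡n (m≤m^2 m)) ⟩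
      ε * q ^ (m ℕ.^ 2) * B                      ∎
      where
      ε = (- 1#) ^ m
      B = [ suc m ] q

    hankelDet-even zero    = sym (trans (*-congʳ (*-identityˡ 1#)) (trans (*-identityˡ _) (+-identityʳ 1#)))
    hankelDet-even (suc m) = cancel m (begin
      B₁ * hankelDet (suc m ℕ.* 2)                      ≈⟨ hankelDet-even-step m ⟩
      - (B₂ * q ^ m) * hankelDet (suc (m ℕ.* 2))        ≈⟨ *-cong (sym (-1*x≈-x _)) (hankelDet-odd m) ⟩
      - 1# * (B₂ * q ^ m) * (ε * q ^ (m ℕ.^ 2) * B₁)    ≈⟨ solve 6 (λ n B₂ x ε y B₁ →
           n :* (B₂ :* x) :* (ε :* y :* B₁) := B₁ :* (n :* ε :* (x :* y) :* B₂))
           refl (- 1#) B₂ (q ^ m) ε (q ^ (m ℕ.^ 2)) B₁ ⟩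
      B₁ * (- 1# * ε * (q ^ m * q ^ (m ℕ.^ 2)) * B₂)    ≈⟨ *-congˡ (*-congʳ (*-congˡ (^-homo-* q m (m ℕ.^ 2)))) ⟨
      B₁ * (- 1# * ε * q ^ (m ℕ.+ m ℕ.^ 2) * B₂)        ≡⟨ ≡.cong (λ k → B₁ * (- 1# * ε * q ^ k * B₂)) (m+m^2≡[1+m]^2∸[1+m] m) ⟩
      B₁ * (- 1# * ε * q ^ (suc m ℕ.^ 2 ℕ.∸ suc m) * B₂) ∎)
      where
      ε = (- 1#) ^ m
      B₁ = [ suc m ] q
      B₂ = [ suc (suc m) ] q

-- Polynomial rings

module PolynomialProperties {c ℓ} (R : CommutativeRing c ℓ) where
  open CommutativeRing R hiding (zero)
  open import Algebra.Properties.Ring ring using (-0#≈0#)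
  open import Algebra.Solver.Ring.NaturalCoefficients.Default commutativeSemiring
    using (solve; _:=_; _:+_; _:*_; con)
  open SetoidReasoning setoid
  open Polynomial rawRing

  infixr 8 _∙_
  _∙_ : Carrier → Poly → Poly
  a ∙ p = map (a *_) p

  negₚ : Poly → Poly
  negₚ = map (-_)

  coeff-+ : ∀ p q k → coeff (p +ₚ q) k ≈ coeff p k + coeff q k
  coeff-+ []      q       k       = sym (+-identityˡ _)
  coeff-+ (a ∷ p) []      k       = sym (+-identityʳ _)
  coeff-+ (a ∷ p) (b ∷ q) zero    = refl
  coeff-+ (a ∷ p) (b ∷ q) (suc k) = coeff-+ p q k

  coeff-∙ : ∀ a p k → coeff (a ∙ p) k ≈ a * coeff p k
  coeff-∙ a []      k       = sym (zeroʳ a)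
  coeff-∙ a (b ∷ p) zero    = refl
  coeff-∙ a (b ∷ p) (suc k) = coeff-∙ a p k

  coeff-neg : ∀ p k → coeff (negₚ p) k ≈ - coeff p k
  coeff-neg []      k       = sym -0#≈0#
  coeff-neg (b ∷ p) zero    = refl
  coeff-neg (b ∷ p) (suc k) = coeff-neg p k

  +ₚ-isAbelianGroup : IsAbelianGroup _≈ₚ_ _+ₚ_ [] negₚ
  +ₚ-isAbelianGroup = record
    { isGroup = record
      { isMonoid = record
        { isSemigroup = record
          { isMagma = record
            { isEquivalence = record
              { refl  = λ k → refl
              ; sym   = λ p≈q k → sym (p≈q k)
              ; trans = λ p≈q q≈r k → trans (p≈q k) (q≈r k)
              }
            ; ∙-cong = λ {p} {q} {r} {s} p≈q r≈s k → begin
                coeff (p +ₚ r) k       ≈⟨ coeff-+ p r k ⟩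
                coeff p k + coeff r k  ≈⟨ +-cong (p≈q k) (r≈s k) ⟩
                coeff q k + coeff s k  ≈⟨ coeff-+ q s k ⟨
                coeff (q +ₚ s) k       ∎
            }
          ; assoc = λ p q r k → begin
              coeff ((p +ₚ q) +ₚ r) k              ≈⟨ coeff-+ (p +ₚ q) r k ⟩
              coeff (p +ₚ q) k + coeff r k         ≈⟨ +-congʳ (coeff-+ p q k) ⟩
              coeff p k + coeff q k + coeff r k    ≈⟨ +-assoc _ _ _ ⟩
              coeff p k + (coeff q k + coeff r k)  ≈⟨ +-congˡ (coeff-+ q r k) ⟨
              coeff p k + coeff (q +ₚ r) k         ≈⟨ coeff-+ p (q +ₚ r) k ⟨
              coeff (p +ₚ (q +ₚ r)) k              ∎
          }
        ; identity = (λ p k → refl) , (λ p k → trans (coeff-+ p [] k) (+-identityʳ _))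
        }
      ; inverse =
          (λ p k → trans (coeff-+ (negₚ p) p k) (trans (+-congʳ (coeff-neg p k)) (-‿inverseˡ _))) ,
          (λ p k → trans (coeff-+ p (negₚ p) k) (trans (+-congˡ (coeff-neg p k)) (-‿inverseʳ _)))
      ; ⁻¹-cong = λ {p} {q} p≈q k → trans (coeff-neg p k) (trans (-‿cong (p≈q k)) (sym (coeff-neg q k)))
      }
    ; comm = λ p q k → trans (coeff-+ p q k) (trans (+-comm _ _) (sym (coeff-+ q p k)))
    }

  private module + = IsAbelianGroup +ₚ-isAbelianGroup

  coeff-∷*ₚ-zero : ∀ a p q → coeff ((a ∷ p) *ₚ q) 0 ≈ a * coeff q 0
  coeff-∷*ₚ-zero a p q = trans (coeff-+ (a ∙ q) (0# ∷ p *ₚ q) 0) (trans (+-identityʳ _) (coeff-∙ a q 0))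

  coeff-∷*ₚ-suc : ∀ a p q k → coeff ((a ∷ p) *ₚ q) (suc k) ≈ a * coeff q (suc k) + coeff (p *ₚ q) k
  coeff-∷*ₚ-suc a p q k = trans (coeff-+ (a ∙ q) (0# ∷ p *ₚ q) (suc k)) (+-congʳ (coeff-∙ a q (suc k)))

  *ₚ-zeroʳ : ∀ p → (p *ₚ []) ≈ₚ []
  *ₚ-zeroʳ []      k       = refl
  *ₚ-zeroʳ (a ∷ p) zero    = refl
  *ₚ-zeroʳ (a ∷ p) (suc k) = *ₚ-zeroʳ p k

  *ₚ-congˡ : ∀ p {q r} → q ≈ₚ r → (p *ₚ q) ≈ₚ (p *ₚ r)
  *ₚ-congˡ []              q≈r k       = refl
  *ₚ-congˡ (a ∷ p) {q} {r} q≈r zero    = begin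
    coeff ((a ∷ p) *ₚ q) 0  ≈⟨ coeff-∷*ₚ-zero a p q ⟩
    a * coeff q 0           ≈⟨ *-congˡ (q≈r 0) ⟩
    a * coeff r 0           ≈⟨ coeff-∷*ₚ-zero a p r ⟨
    coeff ((a ∷ p) *ₚ r) 0  ∎
  *ₚ-congˡ (a ∷ p) {q} {r} q≈r (suc k) = begin
    coeff ((a ∷ p) *ₚ q) (suc k)                ≈⟨ coeff-∷*ₚ-suc a p q k ⟩
    a * coeff q (suc k) + coeff (p *ₚ q) k      ≈⟨ +-cong (*-congˡ (q≈r (suc k))) (*ₚ-congˡ p q≈r k) ⟩
    a * coeff r (suc k) + coeff (p *ₚ r) k      ≈⟨ coeff-∷*ₚ-suc a p r k ⟨
    coeff ((a ∷ p) *ₚ r) (suc k)                ∎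

  coeff-*ₚ∷-zero : ∀ p b q → coeff (p *ₚ (b ∷ q)) 0 ≈ coeff p 0 * b
  coeff-*ₚ∷-zero []      b q = sym (zeroˡ b)
  coeff-*ₚ∷-zero (a ∷ p) b q = coeff-∷*ₚ-zero a p (b ∷ q)

  -- `_*ₚ_` recurses on its left factor, and this is the mirror recursion on the right one.
  -- Comparing the two yields commutativity, which turns left-hand laws into right-hand ones.
  coeff-*ₚ∷-suc : ∀ p b q k → coeff (p *ₚ (b ∷ q)) (suc k) ≈ coeff p (suc k) * b + coeff (p *ₚ q) k
  coeff-*ₚ∷-suc []      b q k = sym (trans (+-identityʳ _) (zeroˡ b))
  coeff-*ₚ∷-suc (a ∷ p) b q zero = begin
    coeff ((a ∷ p) *ₚ (b ∷ q)) 1                    ≈⟨ coeff-∷*ₚ-suc a p (b ∷ q) 0 ⟩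
    a * coeff q 0 + coeff (p *ₚ (b ∷ q)) 0          ≈⟨ +-comm _ _ ⟩
    coeff (p *ₚ (b ∷ q)) 0 + a * coeff q 0          ≈⟨ +-cong (coeff-*ₚ∷-zero p b q) (sym (coeff-∷*ₚ-zero a p q)) ⟩
    coeff p 0 * b + coeff ((a ∷ p) *ₚ q) 0          ∎
  coeff-*ₚ∷-suc (a ∷ p) b q (suc k) = begin
    coeff ((a ∷ p) *ₚ (b ∷ q)) (suc (suc k))                        ≈⟨ coeff-∷*ₚ-suc a p (b ∷ q) (suc k) ⟩
    a * coeff q (suc k) + coeff (p *ₚ (b ∷ q)) (suc k)              ≈⟨ +-congˡ (coeff-*ₚ∷-suc p b q k) ⟩
    a * coeff q (suc k) + (coeff p (suc k) * b + coeff (p *ₚ q) k)  ≈⟨ solve 3 (λ x y z → x :+ (y :+ z) := y :+ (x :+ z)) refl _ _ _ ⟩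
    coeff p (suc k) * b + (a * coeff q (suc k) + coeff (p *ₚ q) k)  ≈⟨ +-congˡ (coeff-∷*ₚ-suc a p q k) ⟨
    coeff p (suc k) * b + coeff ((a ∷ p) *ₚ q) (suc k)              ∎

  *ₚ-comm : ∀ p q → (p *ₚ q) ≈ₚ (q *ₚ p)
  *ₚ-comm []      q k       = sym (*ₚ-zeroʳ q k)
  *ₚ-comm (a ∷ p) q zero    = begin
    coeff ((a ∷ p) *ₚ q) 0  ≈⟨ coeff-∷*ₚ-zero a p q ⟩
    a * coeff q 0           ≈⟨ *-comm a _ ⟩
    coeff q 0 * a           ≈⟨ coeff-*ₚ∷-zero q a p ⟨
    coeff (q *ₚ (a ∷ p)) 0  ∎
  *ₚ-comm (a ∷ p) q (suc k) = begin
    coeff ((a ∷ p) *ₚ q) (suc k)            ≈⟨ coeff-∷*ₚ-suc a p q k ⟩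
    a * coeff q (suc k) + coeff (p *ₚ q) k  ≈⟨ +-cong (*-comm a _) (*ₚ-comm p q k) ⟩
    coeff q (suc k) * a + coeff (q *ₚ p) k  ≈⟨ coeff-*ₚ∷-suc q a p k ⟨
    coeff (q *ₚ (a ∷ p)) (suc k)            ∎

  *ₚ-congʳ : ∀ r {p q} → p ≈ₚ q → (p *ₚ r) ≈ₚ (q *ₚ r)
  *ₚ-congʳ r {p} {q} p≈q k = trans (*ₚ-comm p r k) (trans (*ₚ-congˡ r {p} {q} p≈q k) (*ₚ-comm r q k))

  *ₚ-distribˡ : ∀ p q r → (p *ₚ (q +ₚ r)) ≈ₚ ((p *ₚ q) +ₚ (p *ₚ r))
  *ₚ-distribˡ []      q r k = refl
  *ₚ-distribˡ (a ∷ p) q r zero = begin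
    coeff ((a ∷ p) *ₚ (q +ₚ r)) 0                     ≈⟨ coeff-∷*ₚ-zero a p (q +ₚ r) ⟩
    a * coeff (q +ₚ r) 0                              ≈⟨ *-congˡ (coeff-+ q r 0) ⟩
    a * (coeff q 0 + coeff r 0)                       ≈⟨ distribˡ a _ _ ⟩
    a * coeff q 0 + a * coeff r 0                     ≈⟨ +-cong (coeff-∷*ₚ-zero a p q) (coeff-∷*ₚ-zero a p r) ⟨
    coeff ((a ∷ p) *ₚ q) 0 + coeff ((a ∷ p) *ₚ r) 0   ≈⟨ coeff-+ ((a ∷ p) *ₚ q) ((a ∷ p) *ₚ r) 0 ⟨
    coeff (((a ∷ p) *ₚ q) +ₚ ((a ∷ p) *ₚ r)) 0        ∎
  *ₚ-distribˡ (a ∷ p) q r (suc k) = begin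
    coeff ((a ∷ p) *ₚ (q +ₚ r)) (suc k)                           ≈⟨ coeff-∷*ₚ-suc a p (q +ₚ r) k ⟩
    a * coeff (q +ₚ r) (suc k) + coeff (p *ₚ (q +ₚ r)) k          ≈⟨ +-cong (*-congˡ (coeff-+ q r (suc k)))
                                                                       (trans (*ₚ-distribˡ p q r k) (coeff-+ (p *ₚ q) (p *ₚ r) k)) ⟩
    a * (coeff q (suc k) + coeff r (suc k)) + (coeff (p *ₚ q) k + coeff (p *ₚ r) k)
      ≈⟨ solve 5 (λ a x y z w → a :* (x :+ y) :+ (z :+ w) := (a :* x :+ z) :+ (a :* y :+ w)) refl a _ _ _ _ ⟩
    (a * coeff q (suc k) + coeff (p *ₚ q) k) + (a * coeff r (suc k) + coeff (p *ₚ r) k)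
      ≈⟨ +-cong (coeff-∷*ₚ-suc a p q k) (coeff-∷*ₚ-suc a p r k) ⟨
    coeff ((a ∷ p) *ₚ q) (suc k) + coeff ((a ∷ p) *ₚ r) (suc k)   ≈⟨ coeff-+ ((a ∷ p) *ₚ q) ((a ∷ p) *ₚ r) (suc k) ⟨
    coeff (((a ∷ p) *ₚ q) +ₚ ((a ∷ p) *ₚ r)) (suc k)              ∎

  *ₚ-distribʳ : ∀ r p q → ((p +ₚ q) *ₚ r) ≈ₚ ((p *ₚ r) +ₚ (q *ₚ r))
  *ₚ-distribʳ r p q k = begin
    coeff ((p +ₚ q) *ₚ r) k              ≈⟨ *ₚ-comm (p +ₚ q) r k ⟩
    coeff (r *ₚ (p +ₚ q)) k              ≈⟨ *ₚ-distribˡ r p q k ⟩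
    coeff ((r *ₚ p) +ₚ (r *ₚ q)) k       ≈⟨ +.∙-cong {r *ₚ p} {p *ₚ r} {r *ₚ q} {q *ₚ r} (*ₚ-comm r p) (*ₚ-comm r q) k ⟩
    coeff ((p *ₚ r) +ₚ (q *ₚ r)) k       ∎

  ∙-*ₚ : ∀ a p q k → coeff ((a ∙ p) *ₚ q) k ≈ a * coeff (p *ₚ q) k
  ∙-*ₚ a []      q k    = sym (zeroʳ a)
  ∙-*ₚ a (b ∷ p) q zero = begin
    coeff ((a ∙ (b ∷ p)) *ₚ q) 0   ≈⟨ coeff-∷*ₚ-zero (a * b) (a ∙ p) q ⟩
    a * b * coeff q 0              ≈⟨ *-assoc a b _ ⟩
    a * (b * coeff q 0)            ≈⟨ *-congˡ (coeff-∷*ₚ-zero b p q) ⟨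
    a * coeff ((b ∷ p) *ₚ q) 0     ∎
  ∙-*ₚ a (b ∷ p) q (suc k) = begin
    coeff ((a ∙ (b ∷ p)) *ₚ q) (suc k)                    ≈⟨ coeff-∷*ₚ-suc (a * b) (a ∙ p) q k ⟩
    a * b * coeff q (suc k) + coeff ((a ∙ p) *ₚ q) k      ≈⟨ +-congˡ (∙-*ₚ a p q k) ⟩
    a * b * coeff q (suc k) + a * coeff (p *ₚ q) k        ≈⟨ solve 4 (λ a b x y → a :* b :* x :+ a :* y := a :* (b :* x :+ y)) refl a b _ _ ⟩
    a * (b * coeff q (suc k) + coeff (p *ₚ q) k)          ≈⟨ *-congˡ (coeff-∷*ₚ-suc b p q k) ⟨
    a * coeff ((b ∷ p) *ₚ q) (suc k)                      ∎

  *ₚ-assoc : ∀ p q r → ((p *ₚ q) *ₚ r) ≈ₚ (p *ₚ (q *ₚ r))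
  *ₚ-assoc []      q r k    = refl
  *ₚ-assoc (a ∷ p) q r zero = begin
    coeff (((a ∙ q) +ₚ (0# ∷ p *ₚ q)) *ₚ r) 0                     ≈⟨ *ₚ-distribʳ r (a ∙ q) (0# ∷ p *ₚ q) 0 ⟩
    coeff (((a ∙ q) *ₚ r) +ₚ ((0# ∷ p *ₚ q) *ₚ r)) 0              ≈⟨ coeff-+ ((a ∙ q) *ₚ r) _ 0 ⟩
    coeff ((a ∙ q) *ₚ r) 0 + coeff ((0# ∷ p *ₚ q) *ₚ r) 0         ≈⟨ +-cong (∙-*ₚ a q r 0) (trans (coeff-∷*ₚ-zero 0# (p *ₚ q) r) (zeroˡ _)) ⟩
    a * coeff (q *ₚ r) 0 + 0#                                     ≈⟨ +-identityʳ _ ⟩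
    a * coeff (q *ₚ r) 0                                          ≈⟨ coeff-∷*ₚ-zero a p (q *ₚ r) ⟨
    coeff ((a ∷ p) *ₚ (q *ₚ r)) 0                                 ∎
  *ₚ-assoc (a ∷ p) q r (suc k) = begin
    coeff (((a ∙ q) +ₚ (0# ∷ p *ₚ q)) *ₚ r) (suc k)               ≈⟨ *ₚ-distribʳ r (a ∙ q) (0# ∷ p *ₚ q) (suc k) ⟩
    coeff (((a ∙ q) *ₚ r) +ₚ ((0# ∷ p *ₚ q) *ₚ r)) (suc k)        ≈⟨ coeff-+ ((a ∙ q) *ₚ r) _ (suc k) ⟩
    coeff ((a ∙ q) *ₚ r) (suc k) + coeff ((0# ∷ p *ₚ q) *ₚ r) (suc k)
      ≈⟨ +-cong (∙-*ₚ a q r (suc k)) (trans (coeff-∷*ₚ-suc 0# (p *ₚ q) r k)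
                                            (trans (+-congʳ (zeroˡ _)) (trans (+-identityˡ _) (*ₚ-assoc p q r k)))) ⟩
    a * coeff (q *ₚ r) (suc k) + coeff (p *ₚ (q *ₚ r)) k          ≈⟨ coeff-∷*ₚ-suc a p (q *ₚ r) k ⟨
    coeff ((a ∷ p) *ₚ (q *ₚ r)) (suc k)                           ∎

  *ₚ-identityˡ : ∀ p → (const 1# *ₚ p) ≈ₚ p
  *ₚ-identityˡ p zero    = trans (coeff-∷*ₚ-zero 1# [] p) (*-identityˡ _)
  *ₚ-identityˡ p (suc k) = trans (coeff-∷*ₚ-suc 1# [] p k) (trans (+-identityʳ _) (*-identityˡ _))

  polynomialCommutativeRing : CommutativeRing c ℓ
  polynomialCommutativeRing = record
    { RawRing polynomialRing
    ; isCommutativeRing = record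
      { isRing = record
        { +-isAbelianGroup = +ₚ-isAbelianGroup
        ; *-cong     = λ {p} {q} {r} {s} p≈q r≈s k → trans (*ₚ-congʳ r {p} {q} p≈q k) (*ₚ-congˡ q {r} {s} r≈s k)
        ; *-assoc    = *ₚ-assoc
        ; *-identity = *ₚ-identityˡ , λ p k → trans (*ₚ-comm p (const 1#) k) (*ₚ-identityˡ p k)
        ; distrib    = *ₚ-distribˡ , *ₚ-distribʳ
        }
      ; *-comm = *ₚ-comm
      }
    }

  -- Divisibility by the variable and cancellation

  coeff-var*-zero : ∀ p → coeff (var *ₚ p) 0 ≈ 0#
  coeff-var*-zero p = trans (coeff-∷*ₚ-zero 0# (1# ∷ []) p) (zeroˡ _)

  coeff-var*-suc : ∀ p k → coeff (var *ₚ p) (suc k) ≈ coeff p k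
  coeff-var*-suc p k = begin
    coeff (var *ₚ p) (suc k)                          ≈⟨ coeff-∷*ₚ-suc 0# (1# ∷ []) p k ⟩
    0# * coeff p (suc k) + coeff (const 1# *ₚ p) k    ≈⟨ +-cong (zeroˡ _) (*ₚ-identityˡ p k) ⟩
    0# + coeff p k                                    ≈⟨ +-identityˡ _ ⟩
    coeff p k                                         ∎

  private
    module P = CommutativeRing polynomialCommutativeRing
  open import Algebra.Definitions.RawSemiring (RawRing.rawSemiring polynomialRing) using (sum; _^_)
  open import Algebra.Properties.CommutativeSemigroup P.*-commutativeSemigroup using (x∙yz≈y∙xz)
  import Algebra.Properties.Semiring.Sum P.semiring as Sum

  coeff-sum : ∀ n (a : ℕ → Carrier) → (∀ k → n ℕ.≤ k → a k ≈ 0#) →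
              ∀ k → coeff (sum {n} λ i → const (a (toℕ i)) *ₚ (var ^ toℕ i)) k ≈ a k
  coeff-sum zero    a a≈0 k = sym (a≈0 k z≤n)
  coeff-sum (suc n) a a≈0 k = begin
    coeff ((const (a 0) *ₚ const 1#) +ₚ sum {n} (λ i → const (a (suc (toℕ i))) *ₚ (var *ₚ (var ^ toℕ i)))) k
      ≈⟨ P.+-cong {const (a 0) *ₚ const 1#} {const (a 0)} {rest} {var *ₚ tail} (P.*-identityʳ (const (a 0))) factor k ⟩
    coeff (const (a 0) +ₚ (var *ₚ tail)) k
      ≈⟨ coeff-+ (const (a 0)) (var *ₚ tail) k ⟩
    coeff (const (a 0)) k + coeff (var *ₚ tail) k
      ≈⟨ at-k k ⟩
    a k ∎
    where
    tail rest : Poly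
    tail = sum {n} λ i → const (a (suc (toℕ i))) *ₚ (var ^ toℕ i)
    rest = sum {n} λ i → const (a (suc (toℕ i))) *ₚ (var *ₚ (var ^ toℕ i))
    factor : rest ≈ₚ (var *ₚ tail)
    factor j = begin
      coeff rest j
        ≈⟨ Sum.sum-cong-≋ {n} {λ i → const (a (suc (toℕ i))) *ₚ (var *ₚ (var ^ toℕ i))}
             {λ i → var *ₚ (const (a (suc (toℕ i))) *ₚ (var ^ toℕ i))}
             (λ i → x∙yz≈y∙xz (const (a (suc (toℕ i)))) var (var ^ toℕ i)) j ⟩
      coeff (sum {n} λ i → var *ₚ (const (a (suc (toℕ i))) *ₚ (var ^ toℕ i))) j
        ≈⟨ Sum.*-distribˡ-sum {n} var (λ i → const (a (suc (toℕ i))) *ₚ (var ^ toℕ i)) j ⟨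
      coeff (var *ₚ tail) j ∎
    at-k : ∀ k → coeff (const (a 0)) k + coeff (var *ₚ tail) k ≈ a k
    at-k zero    = trans (+-congˡ (coeff-var*-zero tail)) (+-identityʳ _)
    at-k (suc k) = trans (+-identityˡ _) (trans (coeff-var*-suc tail k)
                     (coeff-sum n (a ∘ suc) (λ j n≤j → a≈0 (suc j) (s≤s n≤j)) k))

  coeff-var^*-low : ∀ n p {k} → k ℕ.< n → coeff ((var ^ n) *ₚ p) k ≈ 0#
  coeff-var^*-low (suc n) p {k} k<1+n = trans (*ₚ-assoc var (var ^ n) p k) (low k<1+n)
    where
    low : ∀ {k} → k ℕ.< suc n → coeff (var *ₚ ((var ^ n) *ₚ p)) k ≈ 0#
    low {zero}  _         = coeff-var*-zero ((var ^ n) *ₚ p)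
    low {suc k} (s≤s k<n) = trans (coeff-var*-suc ((var ^ n) *ₚ p) k) (coeff-var^*-low n p k<n)

  -- Iterating the hypothesis gives p = varⁿ wⁿ p for every n, and a multiple of a high power of
  -- `var` has no low coefficients.
  var-divisible⇒zero : ∀ p w → p ≈ₚ (var *ₚ (w *ₚ p)) → p ≈ₚ []
  var-divisible⇒zero p w p≈ k = let s , p≈s = power (suc k) in
    trans (p≈s k) (coeff-var^*-low (suc k) s ℕ.≤-refl)
    where
    power : ∀ n → ∃ λ s → p ≈ₚ ((var ^ n) *ₚ s)
    power zero    = p , λ j → sym (*ₚ-identityˡ p j)
    power (suc n) with s , p≈s ← power n = w *ₚ s , λ j → begin
      coeff p j
        ≈⟨ p≈ j ⟩
      coeff (var *ₚ (w *ₚ p)) j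
        ≈⟨ *ₚ-congˡ var {w *ₚ p} {(var ^ n) *ₚ (w *ₚ s)} (λ i →
             trans (*ₚ-congˡ w {p} {(var ^ n) *ₚ s} p≈s i) (x∙yz≈y∙xz w (var ^ n) s i)) j ⟩
      coeff (var *ₚ ((var ^ n) *ₚ (w *ₚ s))) j
        ≈⟨ *ₚ-assoc var (var ^ n) (w *ₚ s) j ⟨
      coeff ((var ^ suc n) *ₚ (w *ₚ s)) j ∎

  -- A constant term 1 suffices over any commutative ring: if 1 + var v kills the difference r, then
  -- r = var (-v r), so r is divisible by every power of `var`.
  *ₚ-cancelˡ : ∀ v {p q} → ((const 1# +ₚ (var *ₚ v)) *ₚ p) ≈ₚ ((const 1# +ₚ (var *ₚ v)) *ₚ q) → p ≈ₚ q
  *ₚ-cancelˡ v {p} {q} up≈uq = x∙y⁻¹≈ε⇒x≈y p q (var-divisible⇒zero r (negₚ v) r≈)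
    where
    open import Algebra.Properties.Group P.+-group using (x∙y⁻¹≈ε⇒x≈y; inverseˡ-unique)
    open import Algebra.Properties.Ring P.ring using (-‿distribˡ-*; -‿distribʳ-*)
    module PR = SetoidReasoning P.setoid
    u r : Poly
    u = const 1# +ₚ (var *ₚ v)
    r = p +ₚ (negₚ q)
    ur≈0 : (u *ₚ r) ≈ₚ []
    ur≈0 = PR.begin
      u *ₚ r                      PR.≈⟨ *ₚ-distribˡ u p (negₚ q) ⟩
      (u *ₚ p) +ₚ (u *ₚ (negₚ q))   PR.≈⟨ P.+-cong {u *ₚ p} {u *ₚ q} {u *ₚ (negₚ q)} {negₚ (u *ₚ q)} up≈uq
                                          (λ k → sym (-‿distribʳ-* u q k)) ⟩
      (u *ₚ q) +ₚ (negₚ (u *ₚ q))   PR.≈⟨ P.-‿inverseʳ (u *ₚ q) ⟩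
      []                          PR.∎
    r≈ : r ≈ₚ (var *ₚ ((negₚ v) *ₚ r))
    r≈ = PR.begin
      r                           PR.≈⟨ inverseˡ-unique r ((var *ₚ v) *ₚ r) (λ k → trans (sym (1+ k)) (ur≈0 k)) ⟩
      negₚ ((var *ₚ v) *ₚ r)        PR.≈⟨ -‿distribˡ-* (var *ₚ v) r ⟩
      (negₚ (var *ₚ v)) *ₚ r        PR.≈⟨ *ₚ-congʳ r {negₚ (var *ₚ v)} {var *ₚ (negₚ v)} (-‿distribʳ-* var v) ⟩
      (var *ₚ (negₚ v)) *ₚ r        PR.≈⟨ *ₚ-assoc var (negₚ v) r ⟩
      var *ₚ ((negₚ v) *ₚ r)        PR.∎
      where
      1+ : (u *ₚ r) ≈ₚ (r +ₚ ((var *ₚ v) *ₚ r))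
      1+ = PR.begin
        u *ₚ r                                       PR.≈⟨ *ₚ-distribʳ r (const 1#) (var *ₚ v) ⟩
        (const 1# *ₚ r) +ₚ ((var *ₚ v) *ₚ r)         PR.≈⟨ P.+-congʳ {(var *ₚ v) *ₚ r} {const 1# *ₚ r} {r} (*ₚ-identityˡ r) ⟩
        r +ₚ ((var *ₚ v) *ₚ r)                       PR.∎

-- Narayana numbers

-- On coefficients this is multiplication by t. The value 0 stands for the index -1, which makes
-- Pascal's rule and the path recursion uniform at k = 0.
shift : (ℕ → ℕ) → ℕ → ℕ
shift f zero    = 0
shift f (suc k) = f k

-- Motzkin paths from height 0 to height n in i steps, counted by their
-- number k of down steps and of level steps of weight t.
pathCount : ℕ → ℕ → ℕ → ℕ
pathCount zero    zero    zero    = 1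
pathCount zero    zero    (suc k) = 0
pathCount zero    (suc n) k       = 0
pathCount (suc i) zero    k = (pathCount i 0 k ℕ.+ shift (pathCount i 0) k) ℕ.+ shift (pathCount i 1) k
pathCount (suc i) (suc n) k =
  pathCount i n k ℕ.+ ((pathCount i (suc n) k ℕ.+ shift (pathCount i (suc n)) k)
                       ℕ.+ shift (pathCount i (suc (suc n))) k)

pascal : ∀ n k → suc n choose k ≡ n choose k ℕ.+ shift (n choose_) k
pascal n zero    = ≡.trans (nC0≡1 (suc n)) (≡.sym (≡.cong (ℕ._+ 0) (nC0≡1 n)))
  where
  nC0≡1 : ∀ n → n choose 0 ≡ 1
  nC0≡1 n = ≡.trans (nCk≡nC[n∸k] {0} {n} z≤n) (nCn≡1 n)
pascal n (suc k) = ≡.trans (≡.sym (nCk+nC[k+1]≡[n+1]C[k+1] n k)) (ℕ.+-comm (n choose k) _)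

-- The Lindström–Gessel–Viennot determinant  C(i,k) C(i,k+n) - C(i,k-1) C(i,k+n+1)
-- without subtraction.
pathCount-binomials : ∀ i n k m → m ≡ k ℕ.+ n →
  pathCount i n k ℕ.+ (i choose suc m) ℕ.* shift (i choose_) k ≡ (i choose m) ℕ.* (i choose k)
pathCount-binomials zero    zero    zero    _ ≡.refl = ≡.refl
pathCount-binomials zero    zero    (suc k) _ ≡.refl = ≡.refl
pathCount-binomials zero    (suc n) k       _ ≡.refl rewrite ℕ.+-suc k n = ≡.refl
pathCount-binomials (suc i) n       k       m m≡k+n = go n m≡k+n
  where
  open ≡.≡-Reasoning
  open +-*-Solver
  C S SS : ℕ → ℕ
  C  = i choose_
  S  = shift C
  SS = shift S

  shifted : ∀ n k m → m ≡ k ℕ.+ n →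
            shift (pathCount i (suc n)) k ℕ.+ C (suc m) ℕ.* SS k ≡ C m ℕ.* S k
  shifted n zero    m _    = ≡.trans (ℕ.*-zeroʳ (C (suc m))) (≡.sym (ℕ.*-zeroʳ (C m)))
  shifted n (suc k) m m≡ = pathCount-binomials i (suc n) k m (≡.trans m≡ (≡.sym (ℕ.+-suc k n)))

  shifted₀ : ∀ k → shift (pathCount i 0) k ℕ.+ C k ℕ.* SS k ≡ S k ℕ.* S k
  shifted₀ zero    = ℕ.*-zeroʳ (C 0)
  shifted₀ (suc k) = pathCount-binomials i 0 k k (≡.sym (ℕ.+-identityʳ k))

  pascal² : ∀ k l → (suc i choose k) ℕ.* (suc i choose l) ≡ (C k ℕ.+ S k) ℕ.* (C l ℕ.+ S l)
  pascal² k l = ≡.cong₂ ℕ._*_ (pascal i k) (pascal i l)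

  shiftedPascal : ∀ k → shift (suc i choose_) k ≡ S k ℕ.+ SS k
  shiftedPascal zero    = ≡.refl
  shiftedPascal (suc k) = pascal i k

  -- Pascal's rule splits the subtracted product into four, one for each kind of last step: up, two
  -- level ones, down. At height 0 the step from height -1 is missing, but its determinant C(i,k)
  -- C(i,k-1) - C(i,k-1) C(i,k) is zero, so the unpaired `C k * S k` already fits.
  go : ∀ n {m} → m ≡ k ℕ.+ n →
       pathCount (suc i) n k ℕ.+ (suc i choose suc m) ℕ.* shift (suc i choose_) k
       ≡ (suc i choose m) ℕ.* (suc i choose k)
  go zero    {m} m≡ with ≡.refl ← ≡.trans m≡ (ℕ.+-identityʳ k) = begin
    ((a ℕ.+ b) ℕ.+ d) ℕ.+ (suc i choose suc k) ℕ.* shift (suc i choose_) k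
      ≡⟨ ≡.cong (((a ℕ.+ b) ℕ.+ d) ℕ.+_) (≡.cong₂ ℕ._*_ (pascal i (suc k)) (shiftedPascal k)) ⟩
    ((a ℕ.+ b) ℕ.+ d) ℕ.+ (C (suc k) ℕ.+ C k) ℕ.* (S k ℕ.+ SS k)
      ≡⟨ solve 7 (λ a b d c⁺ c s s⁻ →
           ((a :+ b) :+ d) :+ (c⁺ :+ c) :* (s :+ s⁻)
           := ((a :+ c⁺ :* s) :+ (b :+ c :* s⁻)) :+ ((d :+ c⁺ :* s⁻) :+ c :* s))
           ≡.refl a b d (C (suc k)) (C k) (S k) (SS k) ⟩
    ((a ℕ.+ C (suc k) ℕ.* S k) ℕ.+ (b ℕ.+ C k ℕ.* SS k)) ℕ.+ ((d ℕ.+ C (suc k) ℕ.* SS k) ℕ.+ C k ℕ.* S k)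
      ≡⟨ ≡.cong₂ ℕ._+_ (≡.cong₂ ℕ._+_ (pathCount-binomials i 0 k k (≡.sym (ℕ.+-identityʳ k))) (shifted₀ k))
                       (≡.cong (ℕ._+ C k ℕ.* S k) (shifted 0 k k (≡.sym (ℕ.+-identityʳ k)))) ⟩
    (C k ℕ.* C k ℕ.+ S k ℕ.* S k) ℕ.+ (C k ℕ.* S k ℕ.+ C k ℕ.* S k)
      ≡⟨ solve 2 (λ c s → (c :* c :+ s :* s) :+ (c :* s :+ c :* s) := (c :+ s) :* (c :+ s)) ≡.refl (C k) (S k) ⟩
    (C k ℕ.+ S k) ℕ.* (C k ℕ.+ S k)
      ≡⟨ pascal² k k ⟨
    (suc i choose k) ℕ.* (suc i choose k) ∎
    where
    a b d : ℕ
    a = pathCount i 0 k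
    b = shift (pathCount i 0) k
    d = shift (pathCount i 1) k
  go (suc n) {m} m≡ with ≡.refl ← ≡.trans m≡ (ℕ.+-suc k n) = begin
    (a ℕ.+ ((b ℕ.+ b′) ℕ.+ d)) ℕ.+ (suc i choose suc (suc l)) ℕ.* shift (suc i choose_) k
      ≡⟨ ≡.cong ((a ℕ.+ ((b ℕ.+ b′) ℕ.+ d)) ℕ.+_) (≡.cong₂ ℕ._*_ (pascal i (suc (suc l))) (shiftedPascal k)) ⟩
    (a ℕ.+ ((b ℕ.+ b′) ℕ.+ d)) ℕ.+ (c₂ ℕ.+ c₁) ℕ.* (S k ℕ.+ SS k)
      ≡⟨ solve 8 (λ a b b′ d c₂ c₁ s s⁻ →
           (a :+ ((b :+ b′) :+ d)) :+ (c₂ :+ c₁) :* (s :+ s⁻)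
           := ((a :+ c₁ :* s) :+ (b :+ c₂ :* s)) :+ ((b′ :+ c₁ :* s⁻) :+ (d :+ c₂ :* s⁻)))
           ≡.refl a b b′ d c₂ c₁ (S k) (SS k) ⟩
    ((a ℕ.+ c₁ ℕ.* S k) ℕ.+ (b ℕ.+ c₂ ℕ.* S k)) ℕ.+ ((b′ ℕ.+ c₁ ℕ.* SS k) ℕ.+ (d ℕ.+ c₂ ℕ.* SS k))
      ≡⟨ ≡.cong₂ ℕ._+_ (≡.cong₂ ℕ._+_ (pathCount-binomials i n k l ≡.refl)
                                      (pathCount-binomials i (suc n) k (suc l) (≡.sym (ℕ.+-suc k n))))
                       (≡.cong₂ ℕ._+_ (shifted n k l ≡.refl)
                                      (shifted (suc n) k (suc l) (≡.sym (ℕ.+-suc k n)))) ⟩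
    (C l ℕ.* C k ℕ.+ c₁ ℕ.* C k) ℕ.+ (C l ℕ.* S k ℕ.+ c₁ ℕ.* S k)
      ≡⟨ solve 4 (λ c₁ c₀ c s → (c₀ :* c :+ c₁ :* c) :+ (c₀ :* s :+ c₁ :* s) := (c₁ :+ c₀) :* (c :+ s))
           ≡.refl c₁ (C l) (C k) (S k) ⟩
    (c₁ ℕ.+ C l) ℕ.* (C k ℕ.+ S k)
      ≡⟨ pascal² (suc l) k ⟨
    (suc i choose suc l) ℕ.* (suc i choose k) ∎
    where
    l a b b′ d c₁ c₂ : ℕ
    l  = k ℕ.+ n
    a  = pathCount i n k
    b  = pathCount i (suc n) k
    b′ = shift (pathCount i (suc n)) k
    d  = shift (pathCount i (suc (suc n))) k
    c₁ = C (suc l)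
    c₂ = C (suc (suc l))

-- (k+1) C(n,k+1) = (n-k) C(n,k) without subtraction.
absorption : ∀ n k → suc k ℕ.* (n choose suc k) ℕ.+ k ℕ.* (n choose k) ≡ n ℕ.* (n choose k)
absorption-shift : ∀ n k → k ℕ.* (n choose k) ℕ.+ k ℕ.* shift (n choose_) k ≡ suc n ℕ.* shift (n choose_) k

absorption-shift n zero    = ≡.sym (ℕ.*-zeroʳ (suc n))
absorption-shift n (suc k) = begin
  suc k ℕ.* c⁺ ℕ.+ suc k ℕ.* c    ≡⟨ solve 3 (λ x k c → x :+ (con 1 :+ k) :* c := c :+ (x :+ k :* c)) ≡.refl (suc k ℕ.* c⁺) k c ⟩
  c ℕ.+ (suc k ℕ.* c⁺ ℕ.+ k ℕ.* c) ≡⟨ ≡.cong (c ℕ.+_) (absorption n k) ⟩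
  suc n ℕ.* c                     ∎
  where
  open ≡.≡-Reasoning
  open +-*-Solver
  c⁺ c : ℕ
  c⁺ = n choose suc k
  c  = n choose k

absorption zero    zero    = ≡.refl
absorption zero    (suc k) = ≡.cong₂ ℕ._+_ (ℕ.*-zeroʳ k) (ℕ.*-zeroʳ k)
absorption (suc n) k = begin
  suc k ℕ.* (suc n choose suc k) ℕ.+ k ℕ.* (suc n choose k)
    ≡⟨ ≡.cong₂ (λ x y → suc k ℕ.* x ℕ.+ k ℕ.* y) (pascal n (suc k)) (pascal n k) ⟩
  suc k ℕ.* (c⁺ ℕ.+ c) ℕ.+ k ℕ.* (c ℕ.+ s)
    ≡⟨ solve 4 (λ k c⁺ c s → (con 1 :+ k) :* (c⁺ :+ c) :+ k :* (c :+ s)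
                := ((con 1 :+ k) :* c⁺ :+ k :* c) :+ (c :+ (k :* c :+ k :* s))) ≡.refl k c⁺ c s ⟩
  (suc k ℕ.* c⁺ ℕ.+ k ℕ.* c) ℕ.+ (c ℕ.+ (k ℕ.* c ℕ.+ k ℕ.* s))
    ≡⟨ ≡.cong₂ (λ x y → x ℕ.+ (c ℕ.+ y)) (absorption n k) (absorption-shift n k) ⟩
  n ℕ.* c ℕ.+ (c ℕ.+ suc n ℕ.* s)
    ≡⟨ solve 3 (λ n c s → n :* c :+ (c :+ (con 1 :+ n) :* s) := (con 1 :+ n) :* (c :+ s)) ≡.refl n c s ⟩
  suc n ℕ.* (c ℕ.+ s)
    ≡⟨ ≡.cong (suc n ℕ.*_) (pascal n k) ⟨
  suc n ℕ.* (suc n choose k) ∎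
  where
  open ≡.≡-Reasoning
  open +-*-Solver
  c⁺ c s : ℕ
  c⁺ = n choose suc k
  c  = n choose k
  s  = shift (n choose_) k

pathCount-narayana : ∀ i k → suc k ℕ.* pathCount i 0 k ≡ (suc i choose k) ℕ.* (i choose k)
-- The summand to be cancelled serves twice: on the left its part with `c⁺` completes `a` to the
-- determinant identity, on the right `absorption` turns it into `i * c * s`.
pathCount-narayana i k = ℕ.+-cancelʳ-≡ ((suc k ℕ.* c⁺ ℕ.+ k ℕ.* c) ℕ.* s) _ _ (begin
  suc k ℕ.* a ℕ.+ (suc k ℕ.* c⁺ ℕ.+ k ℕ.* c) ℕ.* s
    ≡⟨ solve 5 (λ k a c⁺ c s → (con 1 :+ k) :* a :+ ((con 1 :+ k) :* c⁺ :+ k :* c) :* s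
                := (con 1 :+ k) :* (a :+ c⁺ :* s) :+ k :* c :* s) ≡.refl k a c⁺ c s ⟩
  suc k ℕ.* (a ℕ.+ c⁺ ℕ.* s) ℕ.+ k ℕ.* c ℕ.* s
    ≡⟨ ≡.cong (λ x → suc k ℕ.* x ℕ.+ k ℕ.* c ℕ.* s) (pathCount-binomials i 0 k k (≡.sym (ℕ.+-identityʳ k))) ⟩
  suc k ℕ.* (c ℕ.* c) ℕ.+ k ℕ.* c ℕ.* s
    ≡⟨ solve 3 (λ k c s → (con 1 :+ k) :* (c :* c) :+ k :* c :* s
                := c :* c :+ c :* (k :* c :+ k :* s)) ≡.refl k c s ⟩
  c ℕ.* c ℕ.+ c ℕ.* (k ℕ.* c ℕ.+ k ℕ.* s)
    ≡⟨ ≡.cong (λ x → c ℕ.* c ℕ.+ c ℕ.* x) (absorption-shift i k) ⟩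
  c ℕ.* c ℕ.+ c ℕ.* (suc i ℕ.* s)
    ≡⟨ solve 3 (λ i c s → c :* c :+ c :* ((con 1 :+ i) :* s) := (c :+ s) :* c :+ i :* c :* s) ≡.refl i c s ⟩
  (c ℕ.+ s) ℕ.* c ℕ.+ i ℕ.* c ℕ.* s
    ≡⟨ ≡.cong₂ (λ x y → x ℕ.* c ℕ.+ y ℕ.* s) (pascal i k) (absorption i k) ⟨
  (suc i choose k) ℕ.* c ℕ.+ (suc k ℕ.* c⁺ ℕ.+ k ℕ.* c) ℕ.* s ∎)
  where
  open ≡.≡-Reasoning
  open +-*-Solver
  a c⁺ c s : ℕ
  a  = pathCount i 0 k
  c⁺ = i choose suc k
  c  = i choose k
  s  = shift (i choose_) k

-- From path counts to rational coefficients

fromℕ : ℕ → ℚ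
fromℕ n = ℤ.+ n ℚ./ 1

fromℕ-+ : ∀ m n → fromℕ (m ℕ.+ n) ≡ fromℕ m ℚ.+ fromℕ n
fromℕ-+ m n = ℚ.toℚᵘ-injective (begin
  ℚ.toℚᵘ (fromℕ (m ℕ.+ n))                    ≈⟨ ℚ.toℚᵘ-fromℚᵘ (ι (m ℕ.+ n)) ⟩
  ι (m ℕ.+ n)                                 ≈⟨ ℚᵘ.*≡* (≡.cong (ℤ._* ℤ.1ℤ) (≡.sym (≡.cong₂ ℤ._+_ (ℤ.*-identityʳ (ℤ.+ m)) (ℤ.*-identityʳ (ℤ.+ n))))) ⟩
  ι m ℚᵘ.+ ι n                                ≈⟨ ℚᵘ.+-cong (ℚ.toℚᵘ-fromℚᵘ (ι m)) (ℚ.toℚᵘ-fromℚᵘ (ι n)) ⟨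
  ℚ.toℚᵘ (fromℕ m) ℚᵘ.+ ℚ.toℚᵘ (fromℕ n)      ≈⟨ ℚ.toℚᵘ-homo-+ (fromℕ m) (fromℕ n) ⟨
  ℚ.toℚᵘ (fromℕ m ℚ.+ fromℕ n)                ∎)
  where
  open import Relation.Binary.Reasoning.Setoid ℚᵘ.≃-setoid
  ι : ℕ → ℚᵘ.ℚᵘ
  ι k = ℚᵘ.mkℚᵘ (ℤ.+ k) 0

/-exact : ∀ m k n → suc k ℕ.* n ≡ m → ℤ.+ m ℚ./ suc k ≡ fromℕ n
/-exact _ k n ≡.refl = ℚ.fromℚᵘ-cong {ℚᵘ.mkℚᵘ (ℤ.+ (suc k ℕ.* n)) k} {ℚᵘ.mkℚᵘ (ℤ.+ n) 0} (ℚᵘ.*≡* (begin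
  ℤ.+ (suc k ℕ.* n) ℤ.* ℤ.1ℤ    ≡⟨ ℤ.*-identityʳ _ ⟩
  ℤ.+ (suc k ℕ.* n)             ≡⟨ ≡.cong ℤ.+_ (ℕ.*-comm (suc k) n) ⟩
  ℤ.+ (n ℕ.* suc k)             ≡⟨ ℤ.pos-* n (suc k) ⟩
  ℤ.+ n ℤ.* ℤ.+ suc k           ∎))
  where open ≡.≡-Reasoning

open import Defs
open Polynomial ℚ.+-*-rawRing using (coeff)
module ℚ[t]-properties = PolynomialProperties ℚ.+-*-commutativeRing
open ℚ[t]-properties using (coeff-+; coeff-var*-zero; coeff-var*-suc; coeff-sum; *ₚ-cancelˡ)
  renaming (polynomialCommutativeRing to ℚ[t]-commutativeRing)
module ℚ[t]-ring = CommutativeRing ℚ[t]-commutativeRing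
open MotzkinPaths ℚ[t]-commutativeRing t
open HankelElimination ℚ[t]-commutativeRing firstAscent using (hankelDet; det≈hankelDet)

-- A record rather than a bare function type, so that `p` and `f` can be inferred from a proof.
record Counts (p : Poly) (f : ℕ → ℕ) : Set where
  constructor counts
  field coeff≡ : ∀ k → coeff p k ≡ fromℕ (f k)
open Counts

counts-+ : ∀ {p q f g} → Counts p f → Counts q g → Counts (p + q) (λ k → f k ℕ.+ g k)
counts-+ {p} {q} {f} {g} cp cq = counts λ k → begin
  coeff (p + q) k                ≡⟨ coeff-+ p q k ⟩
  coeff p k ℚ.+ coeff q k        ≡⟨ ≡.cong₂ ℚ._+_ (coeff≡ cp k) (coeff≡ cq k) ⟩
  fromℕ (f k) ℚ.+ fromℕ (g k)    ≡⟨ fromℕ-+ (f k) (g k) ⟨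
  fromℕ (f k ℕ.+ g k)            ∎
  where open ≡.≡-Reasoning

counts-t* : ∀ {p f} → Counts p f → Counts (t * p) (shift f)
counts-t* {p} {f} cp = counts go
  where
  go : ∀ k → coeff (t * p) k ≡ fromℕ (shift f k)
  go zero    = coeff-var*-zero p
  go (suc k) = ≡.trans (coeff-var*-suc p k) (coeff≡ cp k)

counts-b* : ∀ {p f} → Counts p f → Counts (b * p) (λ k → f k ℕ.+ shift f k)
counts-b* {p} {f} cp = counts λ k →
  ≡.trans (ℚ[t]-ring.distribʳ p 1# t k) (coeff≡ (counts-+ counts-1* (counts-t* cp)) k)
  where
  counts-1* : Counts (1# * p) f
  counts-1* = counts λ k → ≡.trans (ℚ[t]-ring.*-identityˡ p k) (coeff≡ cp k)

counts-paths : ∀ i n → Counts (paths i n) (pathCount i n)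
counts-paths zero    zero    = counts λ { zero → ≡.refl ; (suc k) → ≡.refl }
counts-paths zero    (suc n) = counts λ k → ≡.refl
counts-paths (suc i) zero    = counts-+ (counts-b* (counts-paths i 0)) (counts-t* (counts-paths i 1))
counts-paths (suc i) (suc n) = counts-+ (counts-paths i n)
  (counts-+ (counts-b* (counts-paths i (suc n))) (counts-t* (counts-paths i (suc (suc n)))))

shiftedNarayana≈paths : ∀ i → shiftedNarayana i ≈ paths i 0
shiftedNarayana≈paths i k = begin
  coeff (narayana (suc i)) k      ≡⟨ coeff-sum (suc (suc i)) a a≡0 k ⟩
  a k                             ≡⟨ a≡ k ⟩
  fromℕ (pathCount i 0 k)         ≡⟨ coeff≡ (counts-paths i 0) k ⟨
  coeff (paths i 0) k             ∎
  where
  open ≡.≡-Reasoning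
  a : ℕ → ℚ
  a k = ℤ.+ ((suc i choose k) ℕ.* (i choose k)) ℚ./ suc k
  a≡ : ∀ k → a k ≡ fromℕ (pathCount i 0 k)
  a≡ k = /-exact _ k (pathCount i 0 k) (pathCount-narayana i k)
  a≡0 : ∀ k → suc (suc i) ℕ.≤ k → a k ≡ ℚ.0ℚ
  a≡0 k i<k = ≡.trans (≡.cong (λ x → ℤ.+ (x ℕ.* (i choose k)) ℚ./ suc k) (k>n⇒nCk≡0 i<k)) (ℚ.0/n≡0 (suc k))

narayana⁽⁴⁾≈firstAscent : ∀ i → narayana⁽⁴⁾ i ≈ firstAscent i
narayana⁽⁴⁾≈firstAscent i k = ≡.trans
  (Sum.sum-cong-≋ {suc i} {λ j → shiftedNarayana (toℕ j) * shiftedNarayana (i ℕ.∸ toℕ j)}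
    {λ j → paths (toℕ j) 0 * paths (i ℕ.∸ toℕ j) 0}
    (λ j → ℚ[t]-ring.*-cong {shiftedNarayana (toℕ j)} {paths (toℕ j) 0}
             {shiftedNarayana (i ℕ.∸ toℕ j)} {paths (i ℕ.∸ toℕ j) 0}
             (shiftedNarayana≈paths (toℕ j)) (shiftedNarayana≈paths (i ℕ.∸ toℕ j))) k)
  (paths-⊛ i 0 k)
  where import Algebra.Properties.Semiring.Sum ℚ[t]-ring.semiring as Sum

qInteger-cancelˡ : ∀ m {x y} → [ suc m ] q * x ≈ [ suc m ] q * y → x ≈ y
qInteger-cancelˡ m {x} {y} [1+m]x≈[1+m]y = *ₚ-cancelˡ v λ k → begin
  coeff ((1# + t * v) * x) k     ≡⟨ unit* x k ⟩
  coeff ([ suc m ] q * x) k      ≡⟨ [1+m]x≈[1+m]y k ⟩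
  coeff ([ suc m ] q * y) k      ≡⟨ unit* y k ⟨
  coeff ((1# + t * v) * y) k     ∎
  where
  open ≡.≡-Reasoning
  v : Poly
  -- From [m+1] = 1 + t² [m], with one factor t split off.
  v = t * 1# * [ m ] q
  qInteger≈ : (1# + t * v) ≈ [ suc m ] q
  qInteger≈ k = ≡.trans
    (ℚ[t]-ring.+-congˡ {1#} {t * v} {q * [ m ] q} (λ j → ≡.sym (ℚ[t]-ring.*-assoc t (t * 1#) ([ m ] q) j)) k)
    (≡.sym (qInteger-suc m k))
  unit* : ∀ x → (1# + t * v) * x ≈ [ suc m ] q * x
  unit* x = ℚ[t]-ring.*-congʳ {x} {1# + t * v} {[ suc m ] q} qInteger≈

D₄≈hankelDet : ∀ n → D₄ n ≈ hankelDet n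
D₄≈hankelDet n = det≈hankelDet n {narayana⁽⁴⁾} narayana⁽⁴⁾≈firstAscent

q^e≈t^[2*e] : ∀ e → q ^ e ≈ t ^ (2 ℕ.* e)
q^e≈t^[2*e] = ^-assocʳ t 2
  where open import Algebra.Properties.Semiring.Exp ℚ[t]-ring.semiring using (^-assocʳ)

q-exponent⇒t-exponent : ∀ n e d → d ≈ (- 1#) ^ n * q ^ e * [ suc n ] q → d ≈ (- 1#) ^ n * t ^ (2 ℕ.* e) * [ suc n ] q
q-exponent⇒t-exponent n e d d≈ k = ≡.trans (d≈ k)
  (ℚ[t]-ring.*-congʳ {[ suc n ] q} {(- 1#) ^ n * q ^ e} {(- 1#) ^ n * t ^ (2 ℕ.* e)}
    (ℚ[t]-ring.*-congˡ {(- 1#) ^ n} {q ^ e} {t ^ (2 ℕ.* e)} (q^e≈t^[2*e] e)) k)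

theorem7p4 : ∀ (n : ℕ) →
    (D₄ (2 ℕ.* n) ≈ (- 1#) ^ n * t ^ (2 ℕ.* (n ℕ.^ 2 ℕ.∸ n)) * ([ suc n ] (t ^ 2)))
    × (D₄ (2 ℕ.* n ℕ.+ 1) ≈ (- 1#) ^ n * t ^ (2 ℕ.* n ℕ.^ 2) * ([ suc n ] (t ^ 2)))
theorem7p4 n = q-exponent⇒t-exponent n (n ℕ.^ 2 ℕ.∸ n) (D₄ (2 ℕ.* n)) even , q-exponent⇒t-exponent n (n ℕ.^ 2) (D₄ (2 ℕ.* n ℕ.+ 1)) odd
  where
  open ≡.≡-Reasoning
  even : D₄ (2 ℕ.* n) ≈ (- 1#) ^ n * q ^ (n ℕ.^ 2 ℕ.∸ n) * [ suc n ] q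
  even k = begin
    -- The determinants were computed at size `n * 2`, which unfolds by two successors as `n` grows
    -- by one.
    coeff (D₄ (2 ℕ.* n)) k                  ≡⟨ ≡.cong (λ m → coeff (D₄ m) k) (ℕ.*-comm 2 n) ⟩
    coeff (D₄ (n ℕ.* 2)) k                  ≡⟨ D₄≈hankelDet (n ℕ.* 2) k ⟩
    coeff (hankelDet (n ℕ.* 2)) k           ≡⟨ hankelDet-even qInteger-cancelˡ n k ⟩
    _ ∎
  odd : D₄ (2 ℕ.* n ℕ.+ 1) ≈ (- 1#) ^ n * q ^ (n ℕ.^ 2) * [ suc n ] q
  odd k = begin
    coeff (D₄ (2 ℕ.* n ℕ.+ 1)) k            ≡⟨ ≡.cong (λ m → coeff (D₄ m) k)
                                                 (≡.trans (ℕ.+-comm (2 ℕ.* n) 1) (≡.cong suc (ℕ.*-comm 2 n))) ⟩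
    coeff (D₄ (suc (n ℕ.* 2))) k            ≡⟨ D₄≈hankelDet (suc (n ℕ.* 2)) k ⟩
    coeff (hankelDet (suc (n ℕ.* 2))) k     ≡⟨ hankelDet-odd qInteger-cancelˡ n k ⟩
    _ ∎
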